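{- Let $q\in\mathbb{C}$ with $|q|<1$, let $n$ be a non-negative integer, and let $b,x,y\in\mathbb{C}$ with $|xy|<1$ and $|by|<1$. Then \[ \sum_{m=0}^{\infty}\Phi_{m}^{(q^n)}(b,x|q)\,y^m=\frac{1}{1-xy}\;{}_{2}\varphi_{1}\left(\begin{array}{c} q^n,\,q\\ qxy\end{array};q,\,by\right). \]
   Context: For $a\in\mathbb{C}$ and integers $n\ge 0$, $(a;q)_n=\prod_{k=0}^{n-1}(1-q^k a)$. The $q$-binomial coefficient is $\genfrac{[}{]}{0pt}{}{m}{k}_q=\frac{(q;q)_m}{(q;q)_k(q;q)_{m-k}}$. The homogeneous Hahn polynomials are $\Phi_{m}^{(\alpha)}(x,y|q)=\sum_{k=0}^{m}\genfrac{[}{]}{0pt}{}{m}{k}_{q}(\alpha;q)_{k}x^ky^{m-k}$; thus $\Phi_{m}^{(q^n)}(b,x|q)=\sum_{k=0}^{m}\genfrac{[}{]}{0pt}{}{m}{k}_{q}(q^n;q)_{k}b^kx^{m-k}$. The basic hypergeometric series is \[ {}_{2}\varphi_{1}\left(\begin{array}{c} a_1,a_2\\ b_1\end{array};q,z\right)=\sum_{k=0}^{\infty}\frac{(a_1;q)_k(a_2;q)_k}{(q;q)_k(b_1;q)_k}z^k,\qquad |z|<1. \] -}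

module Defs where

open import Data.Nat.Base as ℕ using (ℕ; zero; suc; _∸_)
import Data.Nat.Properties as ℕP
open import Data.Integer.Base as ℤ using (+_)
import Data.Integer.Properties as ℤP
open import Data.Rational.Base as Q using (ℚ; 0ℚ; 1ℚ; ½; mkℚ; *<*)
import Data.Rational.Properties as ℚP
open import Data.Rational.Unnormalised.Base as Qᵘ using (mkℚᵘ; *≡*; *≤*)
import Data.Rational.Unnormalised.Properties as ℚᵘP
open import Data.Rational.Solver using (module +-*-Solver)
open import Data.Product using (_×_; _,_; proj₁; proj₂; ∃)
open import Data.Sum using (inj₁; inj₂)
open import Relation.Nullary using (Dec; yes; no; contradiction)
open import Relation.Binary.PropositionalEquality
  using (_≡_; refl; sym; trans; cong; cong₂; subst; subst₂)

Eventually : (ℕ → Set) → Set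
Eventually P = ∃ λ N → ∀ n → N ℕ.≤ n → P n

Eventually-× : ∀ {P Q} → Eventually P → Eventually Q → Eventually (λ n → P n × Q n)
Eventually-× (M , p) (N , q) = M ℕ.⊔ N , λ n le →
  p n (ℕP.≤-trans (ℕP.m≤m⊔n M N) le) , q n (ℕP.≤-trans (ℕP.m≤n⊔m M N) le)

Eventually-map : ∀ {P Q} → (∀ n → P n → Q n) → Eventually P → Eventually Q
Eventually-map f (N , p) = N , λ n le → f n (p n le)

module Rational where
  open Q hiding (*≡*; *≤*)
  open +-*-Solver using (solve; _:+_; _:*_; _:-_; :-_; _:=_; con)

  0<1 : 0ℚ < 1ℚ
  0<1 = *<* (ℤ.+<+ (ℕ.s≤s ℕ.z≤n))

  0<½ : 0ℚ < ½
  0<½ = *<* (ℤ.+<+ (ℕ.s≤s ℕ.z≤n))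

  ≤-by : ∀ {p q} d → 0ℚ ≤ d → p + d ≡ q → p ≤ q
  ≤-by {p} d 0≤d eq = subst₂ _≤_ (ℚP.+-identityʳ p) eq (ℚP.+-monoʳ-≤ p 0≤d)

  <-by : ∀ {p q} d → 0ℚ < d → p + d ≡ q → p < q
  <-by {p} d 0<d eq = subst₂ _<_ (ℚP.+-identityʳ p) eq (ℚP.+-monoʳ-< p 0<d)

  p≤q⇒0≤q-p : ∀ {p q} → p ≤ q → 0ℚ ≤ q - p
  p≤q⇒0≤q-p {p} {q} le =
    subst (_≤ q - p) (ℚP.+-inverseʳ p) (ℚP.+-monoˡ-≤ (- p) le)

  p<q⇒0<q-p : ∀ {p q} → p < q → 0ℚ < q - p
  p<q⇒0<q-p {p} {q} lt =
    subst (_< q - p) (ℚP.+-inverseʳ p) (ℚP.+-monoˡ-< (- p) lt)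

  +-nonneg : ∀ {p q} → 0ℚ ≤ p → 0ℚ ≤ q → 0ℚ ≤ p + q
  +-nonneg = ℚP.+-mono-≤

  +-pos : ∀ {p q} → 0ℚ < p → 0ℚ < q → 0ℚ < p + q
  +-pos = ℚP.+-mono-<

  *-nonneg : ∀ {p q} → 0ℚ ≤ p → 0ℚ ≤ q → 0ℚ ≤ p * q
  *-nonneg {p} {q} 0≤p 0≤q = subst (_≤ p * q) (ℚP.*-zeroʳ p)
    (ℚP.*-monoˡ-≤-nonNeg p {{nonNegative 0≤p}} 0≤q)

  *-pos : ∀ {p q} → 0ℚ < p → 0ℚ < q → 0ℚ < p * q
  *-pos {p} {q} 0<p 0<q = subst (_< p * q) (ℚP.*-zeroʳ p)
    (ℚP.*-monoʳ-<-pos p {{positive 0<p}} 0<q)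

  *-mono-≤-nonneg : ∀ {p q r s} → 0ℚ ≤ q → 0ℚ ≤ r → p ≤ q → r ≤ s → p * r ≤ q * s
  *-mono-≤-nonneg {p} {q} {r} {s} 0≤q 0≤r p≤q r≤s = ≤-by _
    (+-nonneg (*-nonneg 0≤q (p≤q⇒0≤q-p r≤s)) (*-nonneg (p≤q⇒0≤q-p p≤q) 0≤r))
    (solve 4 (λ p q r s → p :* r :+ (q :* (s :- r) :+ (q :- p) :* r) := q :* s) refl p q r s)

  p*p-nonneg : ∀ p → 0ℚ ≤ p * p
  p*p-nonneg p with ℚP.≤-total 0ℚ p
  ... | inj₁ 0≤p = *-nonneg 0≤p 0≤p
  ... | inj₂ p≤0 = subst (0ℚ ≤_) (solve 1 (λ p → (:- p) :* (:- p) := p :* p) refl p)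
                     (*-nonneg (ℚP.neg-antimono-≤ p≤0) (ℚP.neg-antimono-≤ p≤0))

  half+half : ∀ ε → ε * ½ + ε * ½ ≡ ε
  half+half = solve 1 (λ ε → ε :* con ½ :+ ε :* con ½ := ε) refl

  half-pos : ∀ {ε} → 0ℚ < ε → 0ℚ < ε * ½
  half-pos 0<ε = *-pos 0<ε 0<½

  p≤∣p∣ : ∀ p → p ≤ ∣ p ∣
  p≤∣p∣ p with ℚP.≤-total 0ℚ p
  ... | inj₁ 0≤p = ℚP.≤-reflexive (sym (ℚP.0≤p⇒∣p∣≡p 0≤p))
  ... | inj₂ p≤0 = ℚP.≤-trans p≤0 (ℚP.0≤∣p∣ p)

  ∣p-q∣≡∣q-p∣ : ∀ p q → ∣ p - q ∣ ≡ ∣ q - p ∣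
  ∣p-q∣≡∣q-p∣ p q = trans (sym (ℚP.∣-p∣≡∣p∣ (p - q)))
    (cong ∣_∣ (solve 2 (λ p q → :- (p :- q) := q :- p) refl p q))

  ∣p-q∣<ε : ∀ {p q ε} → p < q + ε → q < p + ε → ∣ p - q ∣ < ε
  ∣p-q∣<ε {p} {q} {ε} l r with ℚP.∣p∣≡p∨∣p∣≡-p (p - q)
  ... | inj₁ eq = subst (_< ε) (sym eq) (<-by _ (p<q⇒0<q-p l)
    (solve 3 (λ p q ε → p :- q :+ (q :+ ε :- p) := ε) refl p q ε))
  ... | inj₂ eq = subst (_< ε) (sym eq) (<-by _ (p<q⇒0<q-p r)
    (solve 3 (λ p q ε → :- (p :- q) :+ (p :+ ε :- q) := ε) refl p q ε))

  -- Extended by 0⁻¹ = 0.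
  infix 9 _⁻¹
  _⁻¹ : ℚ → ℚ
  p ⁻¹ with p ℚP.≟ 0ℚ
  ... | yes _  = 0ℚ
  ... | no p≢0 = (1/ p) {{≢-nonZero p≢0}}

  ⁻¹-inverseʳ : ∀ {p} → 0ℚ < p → p * p ⁻¹ ≡ 1ℚ
  ⁻¹-inverseʳ {p} 0<p with p ℚP.≟ 0ℚ
  ... | yes p≡0 = contradiction (sym p≡0) (ℚP.<⇒≢ 0<p)
  ... | no p≢0  = ℚP.*-inverseʳ p {{≢-nonZero p≢0}}

  ⁻¹-pos : ∀ {p} → 0ℚ < p → 0ℚ < p ⁻¹
  ⁻¹-pos {p} 0<p with p ℚP.≟ 0ℚ
  ... | yes p≡0 = contradiction (sym p≡0) (ℚP.<⇒≢ 0<p)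
  ... | no p≢0  = ℚP.positive⁻¹ _ {{ℚP.1/pos⇒pos p {{positive 0<p}}}}

  ½^ : ℕ → ℚ
  ½^ zero    = 1ℚ
  ½^ (suc n) = ½ * ½^ n

  fromℕ : ℕ → ℚ
  fromℕ zero    = 0ℚ
  fromℕ (suc n) = 1ℚ + fromℕ n

  fromℕ-nonneg : ∀ n → 0ℚ ≤ fromℕ n
  fromℕ-nonneg zero    = ℚP.≤-refl
  fromℕ-nonneg (suc n) = +-nonneg (ℚP.<⇒≤ 0<1) (fromℕ-nonneg n)

  ½^-pos : ∀ n → 0ℚ < ½^ n
  ½^-pos zero    = 0<1
  ½^-pos (suc n) = *-pos 0<½ (½^-pos n)

  ½^*n≤1 : ∀ n → ½^ n * (1ℚ + fromℕ n) ≤ 1ℚ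
  ½^*n≤1 zero    = ℚP.≤-refl
  ½^*n≤1 (suc n) = ≤-by _
    (+-nonneg (p≤q⇒0≤q-p (½^*n≤1 n))
      (*-nonneg (ℚP.<⇒≤ (*-pos 0<½ (½^-pos n))) (fromℕ-nonneg n)))
    (solve 2 (λ h k → con ½ :* h :* (con 1ℚ :+ (con 1ℚ :+ k))
                :+ ((con 1ℚ :- h :* (con 1ℚ :+ k)) :+ con ½ :* h :* k) := con 1ℚ)
      refl (½^ n) (fromℕ n))

  fromℕ-mono : ∀ {m n} → m ℕ.≤ n → fromℕ m ≤ fromℕ n
  fromℕ-mono {n = n} ℕ.z≤n = fromℕ-nonneg n
  fromℕ-mono (ℕ.s≤s le)    = ℚP.+-monoʳ-≤ 1ℚ (fromℕ-mono le)

  toℚᵘ-fromℕ : ∀ n → toℚᵘ (fromℕ n) Qᵘ.≃ mkℚᵘ (+ n) 0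
  toℚᵘ-fromℕ zero    = ℚᵘP.≃-refl
  toℚᵘ-fromℕ (suc n) = ℚᵘP.≃-trans (ℚP.toℚᵘ-homo-+ 1ℚ (fromℕ n))
    (ℚᵘP.≃-trans (ℚᵘP.+-congʳ (toℚᵘ 1ℚ) (toℚᵘ-fromℕ n))
      (*≡* (cong (λ i → (+ 1 ℤ.+ i) ℤ.* + 1) (ℤP.*-identityʳ (+ n)))))

  archimedean : ∀ {ε} → 0ℚ < ε → ∃ λ D → 1ℚ ≤ ε * fromℕ D
  archimedean {mkℚ (+ zero) d c}  0<ε = contradiction (ℚP.drop-*<* 0<ε) λ { (ℤ.+<+ ()) }
  archimedean {mkℚ ℤ.-[1+ a ] d c} 0<ε = contradiction (ℚP.drop-*<* 0<ε) (λ ())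
  archimedean {ε@(mkℚ (+ suc a) d c)} 0<ε = suc d , ℚP.toℚᵘ-cancel-≤
    (ℚᵘP.≤-trans le (ℚᵘP.≤-reflexive (ℚᵘP.≃-sym
      (ℚᵘP.≃-trans (ℚP.toℚᵘ-homo-* ε (fromℕ (suc d)))
        (ℚᵘP.*-congˡ {mkℚᵘ (+ suc a) d} (toℚᵘ-fromℕ (suc d)))))))
    where
    le : toℚᵘ 1ℚ Qᵘ.≤ mkℚᵘ (+ suc a) d Qᵘ.* mkℚᵘ (+ suc d) 0
    le = *≤* (subst₂ ℤ._≤_ (sym (ℤP.*-identityˡ _)) (sym (ℤP.*-identityʳ _))
      (ℤ.+≤+ (subst (ℕ._≤ suc a ℕ.* suc d) (sym (ℕP.*-identityʳ (suc d)))
        (ℕP.m≤n*m (suc d) (suc a)))))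

  ½^-small : ∀ {ε} → 0ℚ < ε → Eventually (λ n → ½^ n < ε)
  ½^-small {ε} 0<ε with archimedean 0<ε
  ... | D , 1≤εD = D , λ n D≤n → <-by _
    (ℚP.+-mono-≤-< (+-nonneg (+-nonneg
      (*-nonneg (ℚP.<⇒≤ 0<ε) (p≤q⇒0≤q-p (½^*n≤1 n)))
      (*-nonneg (ℚP.<⇒≤ (*-pos 0<ε (½^-pos n))) (p≤q⇒0≤q-p (fromℕ-mono D≤n))))
      (*-nonneg (ℚP.<⇒≤ (½^-pos n)) (p≤q⇒0≤q-p 1≤εD)))
      (*-pos 0<ε (½^-pos n)))
    (solve 4 (λ ε h n D → h :+ (ε :* (con 1ℚ :- h :* (con 1ℚ :+ n)) :+ ε :* h :* (n :- D)
                :+ h :* (ε :* D :- con 1ℚ) :+ ε :* h) := ε)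
      refl ε (½^ n) (fromℕ n) (fromℕ D))

  -- √-lower p n is the lower end of the n-th bisection interval for the square
  -- root of p, starting from [0 , p + 1]; √-lower-spec is the invariant.
  √-step : (p l c : ℚ) → Dec (c * c ≤ p) → ℚ
  √-step p l c (yes _) = c
  √-step p l c (no  _) = l

  √-lower : ℚ → ℕ → ℚ
  √-lower p zero    = 0ℚ
  √-lower p (suc n) = √-step p (√-lower p n) c (c * c ℚP.≤? p)
    where c = √-lower p n + (p + 1ℚ) * ½^ (suc n)

  Brackets√ : (p l w : ℚ) → Set
  Brackets√ p l w = 0ℚ ≤ l × l * l ≤ p × p < (l + w) * (l + w)

  √-lower-spec : ∀ {p} → 0ℚ ≤ p → ∀ n → Brackets√ p (√-lower p n) ((p + 1ℚ) * ½^ n)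
  √-lower-spec {p} 0≤p zero = ℚP.≤-refl , 0≤p ,
    <-by _ (ℚP.+-mono-≤-< (+-nonneg (p*p-nonneg p) 0≤p) 0<1)
      (solve 1 (λ p → p :+ (p :* p :+ p :+ con 1ℚ)
          := (con 0ℚ :+ (p :+ con 1ℚ) :* con 1ℚ) :* (con 0ℚ :+ (p :+ con 1ℚ) :* con 1ℚ)) refl p)
  √-lower-spec {p} 0≤p (suc n) = step (√-lower p n) (½^ n) (½^-pos n)
    (√-lower-spec 0≤p n) (_ ℚP.≤? p)
    where
    step : ∀ l h → 0ℚ < h → Brackets√ p l ((p + 1ℚ) * h) →
      let w = (p + 1ℚ) * (½ * h) in
      (d : Dec ((l + w) * (l + w) ≤ p)) → Brackets√ p (√-step p l (l + w) d) w
    step l h 0<h (0≤l , l²≤p , p<u²) (yes c²≤p) =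
      +-nonneg 0≤l (*-nonneg (+-nonneg 0≤p (ℚP.<⇒≤ 0<1)) (ℚP.<⇒≤ (*-pos 0<½ 0<h))) , c²≤p ,
      subst (λ u → p < u * u)
        (solve 3 (λ l p h → l :+ (p :+ con 1ℚ) :* h
                    := l :+ (p :+ con 1ℚ) :* (con ½ :* h) :+ (p :+ con 1ℚ) :* (con ½ :* h))
          refl l p h) p<u²
    step l h 0<h (0≤l , l²≤p , p<u²) (no c²≰p) = 0≤l , l²≤p , ℚP.≰⇒> c²≰p

  √-close : ∀ {p p′ l l′ w w′ δ} → 0ℚ < δ → 0ℚ ≤ w →
    Brackets√ p l w → Brackets√ p′ l′ w′ → w < δ → p′ < p + δ * δ → l′ < l + (δ + δ)
  √-close {p} {p′} {l} {l′} {w} {_} {δ} 0<δ 0≤w (0≤l , _ , p<u²) (_ , l′²≤p′ , _) w<δ p′<p+δ²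
    with l′ ℚP.<? l + (δ + δ)
  ... | yes lt = lt
  ... | no ¬lt = contradiction refl (ℚP.<⇒≢ absurd)
    where
    0≤δ = ℚP.<⇒≤ 0<δ
    l+2δ≤l′ : l + (δ + δ) ≤ l′
    l+2δ≤l′ = ℚP.≮⇒≥ ¬lt
    0≤l+2δ = +-nonneg 0≤l (+-nonneg 0≤δ 0≤δ)
    absurd : l′ * l′ < l′ * l′
    absurd = begin-strict
      l′ * l′                          ≤⟨ l′²≤p′ ⟩
      p′                               <⟨ p′<p+δ² ⟩
      p + δ * δ                        <⟨ ℚP.+-monoˡ-< (δ * δ) p<u² ⟩
      (l + w) * (l + w) + δ * δ        ≤⟨ ℚP.+-monoˡ-≤ (δ * δ) (*-mono-≤-nonneg
                                            (+-nonneg 0≤l 0≤δ) (+-nonneg 0≤l 0≤w)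
                                            (ℚP.+-monoʳ-≤ l (ℚP.<⇒≤ w<δ)) (ℚP.+-monoʳ-≤ l (ℚP.<⇒≤ w<δ))) ⟩
      (l + δ) * (l + δ) + δ * δ        ≤⟨ ≤-by _ (+-nonneg (*-nonneg 0≤δ 0≤l+2δ) (*-nonneg 0≤l 0≤δ))
                                            (solve 2 (λ l δ → (l :+ δ) :* (l :+ δ) :+ δ :* δ
                                                :+ (δ :* (l :+ (δ :+ δ)) :+ l :* δ)
                                                := (l :+ (δ :+ δ)) :* (l :+ (δ :+ δ))) refl l δ) ⟩
      (l + (δ + δ)) * (l + (δ + δ))    ≤⟨ *-mono-≤-nonneg (ℚP.≤-trans 0≤l+2δ l+2δ≤l′) 0≤l+2δ l+2δ≤l′ l+2δ≤l′ ⟩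
      l′ * l′                          ∎
      where open ℚP.≤-Reasoning

Cauchy : (ℕ → ℚ) → Set
Cauchy s = ∀ ε → 0ℚ Q.< ε →
  ∃ λ N → ∀ m n → N ℕ.≤ m → N ℕ.≤ n → Q.∣ s m Q.- s n ∣ Q.< ε

module CauchySequences where
  open Q hiding (*≡*; *≤*)
  open Rational
  open +-*-Solver using (solve; _:+_; _:*_; _:-_; :-_; _:=_; con)

  ≤ˡ : ∀ M N {k} → M ℕ.⊔ N ℕ.≤ k → M ℕ.≤ k
  ≤ˡ M N = ℕP.≤-trans (ℕP.m≤m⊔n M N)

  ≤ʳ : ∀ M N {k} → M ℕ.⊔ N ℕ.≤ k → N ℕ.≤ k
  ≤ʳ M N = ℕP.≤-trans (ℕP.m≤n⊔m M N)

  bounded : ∀ {s} → Cauchy s → ∃ λ B → 0ℚ < B × Eventually (λ n → ∣ s n ∣ ≤ B)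
  bounded {s} cs with cs 1ℚ 0<1
  ... | N , c = ∣ s N ∣ + 1ℚ , ℚP.+-mono-≤-< (ℚP.0≤∣p∣ (s N)) 0<1 , N , λ n N≤n → begin
    ∣ s n ∣                    ≡⟨ cong ∣_∣ (solve 2 (λ p q → p := q :+ (p :- q)) refl (s n) (s N)) ⟩
    ∣ s N + (s n - s N) ∣      ≤⟨ ℚP.∣p+q∣≤∣p∣+∣q∣ (s N) (s n - s N) ⟩
    ∣ s N ∣ + ∣ s n - s N ∣    ≤⟨ ℚP.+-monoʳ-≤ ∣ s N ∣ (ℚP.<⇒≤ (c n N N≤n ℕP.≤-refl)) ⟩
    ∣ s N ∣ + 1ℚ               ∎
    where open ℚP.≤-Reasoning

  const-cauchy : ∀ p → Cauchy (λ _ → p)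
  const-cauchy p ε 0<ε = 0 , λ _ _ _ _ →
    subst (_< ε) (cong ∣_∣ (sym (ℚP.+-inverseʳ p))) 0<ε

  +-cauchy : ∀ {s t} → Cauchy s → Cauchy t → Cauchy (λ n → s n + t n)
  +-cauchy {s} {t} cs ct ε 0<ε with cs (ε * ½) (half-pos 0<ε) | ct (ε * ½) (half-pos 0<ε)
  ... | M , c | N , d = M ℕ.⊔ N , λ m n m≥ n≥ → begin-strict
    ∣ (s m + t m) - (s n + t n) ∣      ≡⟨ cong ∣_∣ (solve 4 (λ a b c d →
                                            (a :+ b) :- (c :+ d) := (a :- c) :+ (b :- d))
                                            refl (s m) (t m) (s n) (t n)) ⟩
    ∣ (s m - s n) + (t m - t n) ∣      ≤⟨ ℚP.∣p+q∣≤∣p∣+∣q∣ (s m - s n) (t m - t n) ⟩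
    ∣ s m - s n ∣ + ∣ t m - t n ∣      <⟨ ℚP.+-mono-<
                                            (c m n (≤ˡ M N m≥) (≤ˡ M N n≥)) (d m n (≤ʳ M N m≥) (≤ʳ M N n≥)) ⟩
    ε * ½ + ε * ½                      ≡⟨ half+half ε ⟩
    ε                                  ∎
    where open ℚP.≤-Reasoning

  neg-cauchy : ∀ {s} → Cauchy s → Cauchy (λ n → - s n)
  neg-cauchy {s} cs ε 0<ε with cs ε 0<ε
  ... | N , c = N , λ m n m≥ n≥ → subst (_< ε)
    (trans (∣p-q∣≡∣q-p∣ (s m) (s n))
      (cong ∣_∣ (solve 2 (λ a b → b :- a := (:- a) :- (:- b)) refl (s m) (s n))))
    (c m n m≥ n≥)

  ∣ab-cd∣< : ∀ {a b c d A B u v} → 0ℚ < A → 0ℚ < B → ∣ a ∣ ≤ A → ∣ d ∣ ≤ B →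
    ∣ b - d ∣ < u → ∣ a - c ∣ < v → ∣ a * b - c * d ∣ < A * u + v * B
  ∣ab-cd∣< {a} {b} {c} {d} {A} {B} {u} {v} 0<A 0<B a≤A d≤B b-d<u a-c<v = begin-strict
    ∣ a * b - c * d ∣
      ≡⟨ cong ∣_∣ (solve 4 (λ a b c d → a :* b :- c :* d := a :* (b :- d) :+ (a :- c) :* d)
           refl a b c d) ⟩
    ∣ a * (b - d) + (a - c) * d ∣
      ≤⟨ ℚP.∣p+q∣≤∣p∣+∣q∣ (a * (b - d)) ((a - c) * d) ⟩
    ∣ a * (b - d) ∣ + ∣ (a - c) * d ∣
      ≡⟨ cong₂ _+_ (ℚP.∣p*q∣≡∣p∣*∣q∣ a (b - d)) (ℚP.∣p*q∣≡∣p∣*∣q∣ (a - c) d) ⟩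
    ∣ a ∣ * ∣ b - d ∣ + ∣ a - c ∣ * ∣ d ∣
      ≤⟨ ℚP.+-mono-≤
           (ℚP.*-monoʳ-≤-nonNeg ∣ b - d ∣ {{ℚP.∣-∣-nonNeg (b - d)}} a≤A)
           (ℚP.*-monoˡ-≤-nonNeg ∣ a - c ∣ {{ℚP.∣-∣-nonNeg (a - c)}} d≤B) ⟩
    A * ∣ b - d ∣ + ∣ a - c ∣ * B
      <⟨ ℚP.+-mono-<
           (ℚP.*-monoʳ-<-pos A {{positive 0<A}} b-d<u)
           (ℚP.*-monoˡ-<-pos B {{positive 0<B}} a-c<v) ⟩
    A * u + v * B ∎
    where open ℚP.≤-Reasoning

  halves : ∀ {A B} h → 0ℚ < A → 0ℚ < B → A * (h * A ⁻¹) + h * B ⁻¹ * B ≡ h + h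
  halves {A} {B} h 0<A 0<B = trans
    (solve 5 (λ A A′ B B′ h → A :* (h :* A′) :+ h :* B′ :* B
        := h :* (A :* A′) :+ h :* (B :* B′)) refl A (A ⁻¹) B (B ⁻¹) h)
    (cong₂ _+_ (trans (cong (h *_) (⁻¹-inverseʳ 0<A)) (ℚP.*-identityʳ h))
               (trans (cong (h *_) (⁻¹-inverseʳ 0<B)) (ℚP.*-identityʳ h)))

  *-cauchy : ∀ {s t} → Cauchy s → Cauchy t → Cauchy (λ n → s n * t n)
  *-cauchy {s} {t} cs ct ε 0<ε = go (bounded cs) (bounded ct)
    where
    go : (∃ λ A → 0ℚ < A × Eventually (λ n → ∣ s n ∣ ≤ A)) →
         (∃ λ B → 0ℚ < B × Eventually (λ n → ∣ t n ∣ ≤ B)) →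
         ∃ λ N → ∀ m n → N ℕ.≤ m → N ℕ.≤ n → ∣ s m * t m - s n * t n ∣ < ε
    go (A , 0<A , K , s≤A) (B , 0<B , L , t≤B) = (K ℕ.⊔ L) ℕ.⊔ (M ℕ.⊔ N) , λ m n m≥ n≥ →
      subst (∣ s m * t m - s n * t n ∣ <_) split
        (∣ab-cd∣< {s m} {t m} {s n} {t n} {A} {B} {u} {v} 0<A 0<B
          (s≤A m (≤ˡ K L (≤ˡ (K ℕ.⊔ L) (M ℕ.⊔ N) m≥))) (t≤B n (≤ʳ K L (≤ˡ (K ℕ.⊔ L) (M ℕ.⊔ N) n≥)))
          (proj₂ d m n (≤ʳ M N (≤ʳ (K ℕ.⊔ L) (M ℕ.⊔ N) m≥)) (≤ʳ M N (≤ʳ (K ℕ.⊔ L) (M ℕ.⊔ N) n≥)))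
          (proj₂ c m n (≤ˡ M N (≤ʳ (K ℕ.⊔ L) (M ℕ.⊔ N) m≥)) (≤ˡ M N (≤ʳ (K ℕ.⊔ L) (M ℕ.⊔ N) n≥))))
      where
      u = ε * ½ * A ⁻¹
      v = ε * ½ * B ⁻¹
      0<u : 0ℚ < u
      0<u = *-pos {ε * ½} {A ⁻¹} (half-pos 0<ε) (⁻¹-pos 0<A)
      0<v : 0ℚ < v
      0<v = *-pos {ε * ½} {B ⁻¹} (half-pos 0<ε) (⁻¹-pos 0<B)
      split : A * u + v * B ≡ ε
      split = trans (halves (ε * ½) 0<A 0<B) (half+half ε)
      c = cs v 0<v
      d = ct u 0<u
      M = proj₁ c
      N = proj₁ d

  ⁻¹-cauchy : ∀ {s ε} → Cauchy s → 0ℚ < ε → Eventually (λ n → ε ≤ s n) → Cauchy (λ n → s n ⁻¹)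
  ⁻¹-cauchy {s} {ε} cs 0<ε (K , ε≤s) η 0<η with cs (η * (ε * ε)) (*-pos 0<η (*-pos 0<ε 0<ε))
  ... | N , c = K ℕ.⊔ N , λ m n m≥ n≥ →
    let K≤m = ≤ˡ K N m≥
        K≤n = ≤ˡ K N n≥
        N≤m = ≤ʳ K N m≥
        N≤n = ≤ʳ K N n≥
    in ℚP.*-cancelʳ-<-nonNeg (s m * s n)
         {{nonNegative (*-nonneg (0≤s m K≤m) (0≤s n K≤n))}} (begin-strict
    ∣ s m ⁻¹ - s n ⁻¹ ∣ * (s m * s n)
      ≡⟨ cong (∣ s m ⁻¹ - s n ⁻¹ ∣ *_) (sym (ℚP.0≤p⇒∣p∣≡p (*-nonneg (0≤s m K≤m) (0≤s n K≤n)))) ⟩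
    ∣ s m ⁻¹ - s n ⁻¹ ∣ * ∣ s m * s n ∣
      ≡⟨ sym (ℚP.∣p*q∣≡∣p∣*∣q∣ (s m ⁻¹ - s n ⁻¹) (s m * s n)) ⟩
    ∣ (s m ⁻¹ - s n ⁻¹) * (s m * s n) ∣
      ≡⟨ cong ∣_∣ (solve 4 (λ a a′ b b′ → (a′ :- b′) :* (a :* b)
                     := (a :* a′) :* b :- (b :* b′) :* a) refl (s m) (s m ⁻¹) (s n) (s n ⁻¹)) ⟩
    ∣ s m * s m ⁻¹ * s n - s n * s n ⁻¹ * s m ∣
      ≡⟨ cong₂ (λ a b → ∣ a * s n - b * s m ∣)
           (⁻¹-inverseʳ (0<s m K≤m)) (⁻¹-inverseʳ (0<s n K≤n)) ⟩
    ∣ 1ℚ * s n - 1ℚ * s m ∣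
      ≡⟨ cong₂ (λ a b → ∣ a - b ∣) (ℚP.*-identityˡ (s n)) (ℚP.*-identityˡ (s m)) ⟩
    ∣ s n - s m ∣
      <⟨ c n m N≤n N≤m ⟩
    η * (ε * ε)
      ≤⟨ ℚP.*-monoˡ-≤-nonNeg η {{nonNegative (ℚP.<⇒≤ 0<η)}}
           (*-mono-≤-nonneg (0≤s m K≤m) (ℚP.<⇒≤ 0<ε) (ε≤s m K≤m) (ε≤s n K≤n)) ⟩
    η * (s m * s n) ∎)
    where
    open ℚP.≤-Reasoning
    0<s : ∀ k → K ℕ.≤ k → 0ℚ < s k
    0<s k le = ℚP.<-≤-trans 0<ε (ε≤s k le)
    0≤s : ∀ k → K ℕ.≤ k → 0ℚ ≤ s k
    0≤s k le = ℚP.<⇒≤ (0<s k le)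

  √-width-small : ∀ {s} → Cauchy s → (∀ n → 0ℚ ≤ s n) → ∀ {δ} → 0ℚ < δ →
    Eventually (λ n → (s n + 1ℚ) * ½^ n < δ)
  √-width-small {s} cs 0≤s {δ} 0<δ = go (bounded cs)
    where
    open ℚP.≤-Reasoning
    go : (∃ λ B → 0ℚ < B × Eventually (λ n → ∣ s n ∣ ≤ B)) →
         Eventually (λ n → (s n + 1ℚ) * ½^ n < δ)
    go (B , 0<B , evB) = Eventually-map {P} {Q} P⇒Q
      (Eventually-× {λ n → ∣ s n ∣ ≤ B} {λ n → ½^ n < δ * C ⁻¹} evB (½^-small {δ * C ⁻¹} 0<δC⁻¹))
      where
      C = B + 1ℚ
      0<C : 0ℚ < C
      0<C = +-pos {B} {1ℚ} 0<B 0<1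
      0<δC⁻¹ : 0ℚ < δ * C ⁻¹
      0<δC⁻¹ = *-pos {δ} {C ⁻¹} 0<δ (⁻¹-pos 0<C)
      P Q : ℕ → Set
      P n = ∣ s n ∣ ≤ B × ½^ n < δ * C ⁻¹
      Q n = (s n + 1ℚ) * ½^ n < δ
      P⇒Q : ∀ n → P n → Q n
      P⇒Q n (∣s∣≤B , h<) = begin-strict
        (s n + 1ℚ) * ½^ n
          ≤⟨ ℚP.*-monoʳ-≤-nonNeg (½^ n) {{nonNegative (ℚP.<⇒≤ (½^-pos n))}}
               (ℚP.+-monoˡ-≤ 1ℚ (ℚP.≤-trans (p≤∣p∣ (s n)) ∣s∣≤B)) ⟩
        C * ½^ n
          <⟨ ℚP.*-monoʳ-<-pos C {{positive 0<C}} h< ⟩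
        C * (δ * C ⁻¹)
          ≡⟨ solve 3 (λ C C′ δ → C :* (δ :* C′) := δ :* (C :* C′)) refl C (C ⁻¹) δ ⟩
        δ * (C * C ⁻¹)
          ≡⟨ trans (cong (δ *_) (⁻¹-inverseʳ 0<C)) (ℚP.*-identityʳ δ) ⟩
        δ ∎

  √-cauchy : ∀ {s} → Cauchy s → (∀ n → 0ℚ ≤ s n) → Cauchy (λ n → √-lower (s n) n)
  √-cauchy {s} cs 0≤s ε 0<ε = M ℕ.⊔ N , λ m n m≥ n≥ →
    ∣p-q∣<ε (side n m n≥ m≥) (side m n m≥ n≥)
    where
    δ = ε * ½
    0<δ : 0ℚ < δ
    0<δ = half-pos 0<ε
    0<δ² : 0ℚ < δ * δ
    0<δ² = *-pos {δ} {δ} 0<δ 0<δ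
    small = √-width-small cs 0≤s {δ} 0<δ
    close = cs (δ * δ) 0<δ²
    M = proj₁ small
    N = proj₁ close
    side : ∀ m n → M ℕ.⊔ N ℕ.≤ m → M ℕ.⊔ N ℕ.≤ n → √-lower (s n) n < √-lower (s m) m + ε
    side m n m≥ n≥ = subst (λ e → √-lower (s n) n < √-lower (s m) m + e) (half+half ε)
      (√-close {s m} {s n} {√-lower (s m) m} {√-lower (s n) n} {w m} {w n} {δ} 0<δ
        (*-nonneg {s m + 1ℚ} {½^ m} (+-nonneg {s m} {1ℚ} (0≤s m) (ℚP.<⇒≤ 0<1)) (ℚP.<⇒≤ (½^-pos m)))
        (√-lower-spec (0≤s m) m) (√-lower-spec (0≤s n) n)
        (proj₂ small m (≤ˡ M N m≥))
        (subst (_< s m + δ * δ) (solve 2 (λ a b → a :+ (b :- a) := b) refl (s m) (s n))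
          (ℚP.+-monoʳ-< (s m) (ℚP.≤-<-trans (p≤∣p∣ (s n - s m))
            (proj₂ close n m (≤ʳ M N n≥) (≤ʳ M N m≥))))))
      where
      w : ℕ → ℚ
      w k = (s k + 1ℚ) * ½^ k

record ℝ : Set where
  constructor mkℝ
  field
    seq    : ℕ → ℚ
    cauchy : Cauchy seq

open ℝ public

infix  4 _≈ᴿ_ _<ᴿ_
infixl 6 _+ᴿ_
infixl 7 _*ᴿ_
infix  8 -ᴿ_

_≈ᴿ_ : ℝ → ℝ → Set
x ≈ᴿ y = ∀ ε → 0ℚ Q.< ε → Eventually (λ n → Q.∣ seq x n Q.- seq y n ∣ Q.< ε)

-- The strict order needs a uniform gap: seq x n < seq y n eventually would only give x ≤ y.
record _<ᴿ_ (x y : ℝ) : Set where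
  constructor gap
  field
    ε          : ℚ
    ε-positive : 0ℚ Q.< ε
    separated  : Eventually (λ n → seq x n Q.+ ε Q.≤ seq y n)

-- Abstract, so that conversion checking never unfolds moduli of convergence.
abstract
  const-cauchy : ∀ p → Cauchy (λ _ → p)
  const-cauchy = CauchySequences.const-cauchy

  +-cauchy : ∀ x y → Cauchy (λ n → seq x n Q.+ seq y n)
  +-cauchy x y = CauchySequences.+-cauchy {seq x} {seq y} (cauchy x) (cauchy y)

  *-cauchy : ∀ x y → Cauchy (λ n → seq x n Q.* seq y n)
  *-cauchy x y = CauchySequences.*-cauchy {seq x} {seq y} (cauchy x) (cauchy y)

  neg-cauchy : ∀ x → Cauchy (λ n → Q.- seq x n)
  neg-cauchy x = CauchySequences.neg-cauchy {seq x} (cauchy x)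

0ℝ 1ℝ : ℝ
0ℝ = mkℝ (λ _ → 0ℚ) (const-cauchy 0ℚ)
1ℝ = mkℝ (λ _ → 1ℚ) (const-cauchy 1ℚ)

_+ᴿ_ _*ᴿ_ : ℝ → ℝ → ℝ
x +ᴿ y = mkℝ (λ n → seq x n Q.+ seq y n) (+-cauchy x y)
x *ᴿ y = mkℝ (λ n → seq x n Q.* seq y n) (*-cauchy x y)

-ᴿ_ : ℝ → ℝ
-ᴿ x = mkℝ (λ n → Q.- seq x n) (neg-cauchy x)

abstract
  ⁻¹-cauchy : ∀ x → 0ℝ <ᴿ x → Cauchy (λ n → seq x n Rational.⁻¹)
  ⁻¹-cauchy x (gap ε 0<ε ev) = CauchySequences.⁻¹-cauchy {seq x} (cauchy x) 0<ε
    (Eventually-map (λ n → subst (Q._≤ seq x n) (ℚP.+-identityˡ ε)) ev)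

  √-cauchy : ∀ x → (∀ n → 0ℚ Q.≤ seq x n) → Cauchy (λ n → Rational.√-lower (seq x n) n)
  √-cauchy x = CauchySequences.√-cauchy {seq x} (cauchy x)

recipᴿ : (x : ℝ) → 0ℝ <ᴿ x → ℝ
recipᴿ x 0<x = mkℝ (λ n → seq x n Rational.⁻¹) (⁻¹-cauchy x 0<x)

-- The n-th approximation is the n-th bisection step for the square root of seq x n.
√ : (x : ℝ) → (∀ n → 0ℚ Q.≤ seq x n) → ℝ
√ x 0≤x = mkℝ (λ n → Rational.√-lower (seq x n) n) (√-cauchy x 0≤x)

record ℂ : Set where
  constructor _+i_
  field
    re im : ℝ

open ℂ public

infix  4 _≈_ _≠0
infixl 6 _+_ _-_
infixl 7 _*_ _/_⟨_⟩
infix  8 -_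
infixr 9 _^_

_≈_ : ℂ → ℂ → Set
z ≈ w = re z ≈ᴿ re w × im z ≈ᴿ im w

0ℂ 1ℂ : ℂ
0ℂ = 0ℝ +i 0ℝ
1ℂ = 1ℝ +i 0ℝ

-_ : ℂ → ℂ
- z = (-ᴿ re z) +i (-ᴿ im z)

_+_ _*_ _-_ : ℂ → ℂ → ℂ
z + w = (re z +ᴿ re w) +i (im z +ᴿ im w)
z * w = (re z *ᴿ re w +ᴿ -ᴿ (im z *ᴿ im w)) +i (re z *ᴿ im w +ᴿ im z *ᴿ re w)
z - w = z + - w

_^_ : ℂ → ℕ → ℂ
z ^ zero  = 1ℂ
z ^ suc n = z ^ n * z

normSq : ℂ → ℝ
normSq z = re z *ᴿ re z +ᴿ im z *ᴿ im z

normSq-nonneg : ∀ z n → 0ℚ Q.≤ seq (normSq z) n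
normSq-nonneg z n =
  Rational.+-nonneg (Rational.p*p-nonneg (seq (re z) n)) (Rational.p*p-nonneg (seq (im z) n))

∣_∣ : ℂ → ℝ
∣ z ∣ = √ (normSq z) (normSq-nonneg z)

-- Apartness from 0, the constructive domain of division.
_≠0 : ℂ → Set
z ≠0 = 0ℝ <ᴿ normSq z

_/_⟨_⟩ : (z w : ℂ) → w ≠0 → ℂ
z / w ⟨ w≠0 ⟩ = z * ((re w *ᴿ r) +i (-ᴿ im w *ᴿ r))
  where r = recipᴿ (normSq w) w≠0

∑< : ℕ → (ℕ → ℂ) → ℂ
∑< zero    f = 0ℂ
∑< (suc n) f = ∑< n f + f n

HasSum : (ℕ → ℂ) → ℂ → Set
HasSum f s = ∀ ε → 0ℝ <ᴿ ε → Eventually (λ N → ∣ ∑< N f - s ∣ <ᴿ ε)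

pochhammer : (a q : ℂ) → ℕ → ℂ
pochhammer a q zero    = 1ℂ
pochhammer a q (suc n) = pochhammer a q n * (1ℂ - q ^ n * a)

module NonVanishing where
  open Q using (_≤_; _<_; positive; nonNegative)
  open Rational
  open +-*-Solver using (solve; _:+_; _:*_; _:-_; :-_; _:=_; con)

  normSq-* : ∀ z w n → seq (normSq (z * w)) n ≡ seq (normSq z) n Q.* seq (normSq w) n
  normSq-* z w n = solve 4 (λ a b c d →
      (a :* c :+ :- (b :* d)) :* (a :* c :+ :- (b :* d)) :+ (a :* d :+ b :* c) :* (a :* d :+ b :* c)
      := (a :* a :+ b :* b) :* (c :* c :+ d :* d))
    refl (seq (re z) n) (seq (im z) n) (seq (re w) n) (seq (im w) n)

  *-≠0 : ∀ z w → z ≠0 → w ≠0 → z * w ≠0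
  *-≠0 z w (gap ε 0<ε evz) (gap η 0<η evw) = gap (ε Q.* η) (*-pos {ε} {η} 0<ε 0<η)
    (Eventually-map {P} {Q} P⇒Q (Eventually-× evz evw))
    where
    P Q : ℕ → Set
    P n = 0ℚ Q.+ ε ≤ seq (normSq z) n × 0ℚ Q.+ η ≤ seq (normSq w) n
    Q n = 0ℚ Q.+ ε Q.* η ≤ seq (normSq (z * w)) n
    P⇒Q : ∀ n → P n → Q n
    P⇒Q n (p , q) = subst₂ _≤_ (sym (ℚP.+-identityˡ (ε Q.* η))) (sym (normSq-* z w n))
      (*-mono-≤-nonneg {ε} {seq (normSq z) n} {η} {seq (normSq w) n} (normSq-nonneg z n) (ℚP.<⇒≤ 0<η)
        (subst (_≤ seq (normSq z) n) (ℚP.+-identityˡ ε) p)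
        (subst (_≤ seq (normSq w) n) (ℚP.+-identityˡ η) q))

  1ℂ-≠0 : 1ℂ ≠0
  1ℂ-≠0 = gap 1ℚ 0<1 (0 , λ _ _ → ℚP.≤-refl)

  ∣z∣<1⇒normSq<1 : ∀ z → ∣ z ∣ <ᴿ 1ℝ → normSq z <ᴿ 1ℝ
  ∣z∣<1⇒normSq<1 z (gap ε 0<ε ev) = gap δ 0<δ
    (Eventually-map {P} {Q} P⇒Q (Eventually-× ev
      (CauchySequences.√-width-small (cauchy (normSq z)) (normSq-nonneg z) {δ} 0<δ)))
    where
    δ = ε Q.* ½
    0<δ : 0ℚ < δ
    0<δ = half-pos 0<ε
    p l w : ℕ → ℚ
    p n = seq (normSq z) n
    l n = √-lower (p n) n
    w n = (p n Q.+ 1ℚ) Q.* ½^ n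
    P Q : ℕ → Set
    P n = l n Q.+ ε ≤ 1ℚ × w n < δ
    Q n = p n Q.+ δ ≤ 1ℚ
    core : ∀ {p l w} → 0ℚ ≤ w → Brackets√ p l w → l Q.+ ε ≤ 1ℚ → w < δ → p Q.+ δ ≤ 1ℚ
    core {p} {l} {w} 0≤w (0≤l , _ , p<u²) l+ε≤1 w<δ = begin
      p Q.+ δ
        ≤⟨ ℚP.+-monoˡ-≤ δ (ℚP.<⇒≤ p<u²) ⟩
      (l Q.+ w) Q.* (l Q.+ w) Q.+ δ
        ≤⟨ ℚP.+-monoˡ-≤ δ (ℚP.*-monoˡ-≤-nonNeg (l Q.+ w) {{nonNegative 0≤u}} u≤1) ⟩
      (l Q.+ w) Q.* 1ℚ Q.+ δ
        ≡⟨ cong (Q._+ δ) (ℚP.*-identityʳ (l Q.+ w)) ⟩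
      l Q.+ w Q.+ δ
        ≤⟨ u+δ≤1 ⟩
      1ℚ ∎
      where
      open ℚP.≤-Reasoning
      0≤u : 0ℚ ≤ l Q.+ w
      0≤u = +-nonneg {l} {w} 0≤l 0≤w
      u+δ≤1 : l Q.+ w Q.+ δ ≤ 1ℚ
      u+δ≤1 = begin
        l Q.+ w Q.+ δ    ≤⟨ ℚP.+-monoˡ-≤ δ (ℚP.+-monoʳ-≤ l (ℚP.<⇒≤ w<δ)) ⟩
        l Q.+ δ Q.+ δ    ≡⟨ trans (ℚP.+-assoc l δ δ) (cong (l Q.+_) (half+half ε)) ⟩
        l Q.+ ε          ≤⟨ l+ε≤1 ⟩
        1ℚ               ∎
      u≤1 : l Q.+ w ≤ 1ℚ
      u≤1 = ℚP.≤-trans (≤-by {l Q.+ w} δ (ℚP.<⇒≤ 0<δ) refl) u+δ≤1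
    P⇒Q : ∀ n → P n → Q n
    P⇒Q n (a , b) = core {p n} {l n} {w n}
      (*-nonneg {p n Q.+ 1ℚ} {½^ n}
        (+-nonneg {p n} {1ℚ} (normSq-nonneg z n) (ℚP.<⇒≤ 0<1)) (ℚP.<⇒≤ (½^-pos n)))
      (√-lower-spec (normSq-nonneg z n) n) a b

  normSq≤1 : ℂ → Set
  normSq≤1 z = Eventually (λ n → seq (normSq z) n ≤ 1ℚ)

  <1⇒≤1 : ∀ z → normSq z <ᴿ 1ℝ → normSq≤1 z
  <1⇒≤1 z (gap ε 0<ε ev) = Eventually-map
    (λ n le → ℚP.≤-trans (≤-by {seq (normSq z) n} ε (ℚP.<⇒≤ 0<ε) refl) le) ev

  *-≤1-<1 : ∀ z w → normSq≤1 z → normSq w <ᴿ 1ℝ → normSq (z * w) <ᴿ 1ℝ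
  *-≤1-<1 z w evz (gap ε 0<ε evw) =
    gap ε 0<ε (Eventually-map {P} {Q} P⇒Q (Eventually-× evz evw))
    where
    open ℚP.≤-Reasoning
    P Q : ℕ → Set
    P n = seq (normSq z) n ≤ 1ℚ × seq (normSq w) n Q.+ ε ≤ 1ℚ
    Q n = seq (normSq (z * w)) n Q.+ ε ≤ 1ℚ
    P⇒Q : ∀ n → P n → Q n
    P⇒Q n (a , b) = begin
      seq (normSq (z * w)) n Q.+ ε
        ≡⟨ cong (Q._+ ε) (normSq-* z w n) ⟩
      seq (normSq z) n Q.* seq (normSq w) n Q.+ ε
        ≤⟨ ℚP.+-monoˡ-≤ ε (ℚP.*-monoʳ-≤-nonNeg (seq (normSq w) n)
             {{nonNegative (normSq-nonneg w n)}} a) ⟩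
      1ℚ Q.* seq (normSq w) n Q.+ ε
        ≡⟨ cong (Q._+ ε) (ℚP.*-identityˡ (seq (normSq w) n)) ⟩
      seq (normSq w) n Q.+ ε
        ≤⟨ b ⟩
      1ℚ ∎

  *-≤1 : ∀ z w → normSq≤1 z → normSq≤1 w → normSq≤1 (z * w)
  *-≤1 z w evz evw = Eventually-map {P} {Q} P⇒Q (Eventually-× evz evw)
    where
    P Q : ℕ → Set
    P n = seq (normSq z) n ≤ 1ℚ × seq (normSq w) n ≤ 1ℚ
    Q n = seq (normSq (z * w)) n ≤ 1ℚ
    P⇒Q : ∀ n → P n → Q n
    P⇒Q n (a , b) = subst (_≤ 1ℚ) (sym (normSq-* z w n))
      (*-mono-≤-nonneg {seq (normSq z) n} {1ℚ} {seq (normSq w) n} {1ℚ}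
        (ℚP.<⇒≤ 0<1) (normSq-nonneg w n) a b)

  ^-≤1 : ∀ q → normSq≤1 q → ∀ n → normSq≤1 (q ^ n)
  ^-≤1 q q≤1 zero    = 0 , λ _ _ → ℚP.≤-refl
  ^-≤1 q q≤1 (suc n) = *-≤1 (q ^ n) q (^-≤1 q q≤1 n) q≤1

  normSq<1⇒1-z≠0 : ∀ z → normSq z <ᴿ 1ℝ → 1ℂ - z ≠0
  normSq<1⇒1-z≠0 z (gap ε 0<ε ev) =
    gap (δ Q.* δ) (*-pos {δ} {δ} 0<δ 0<δ) (Eventually-map {P} {Q} P⇒Q ev)
    where
    open ℚP.≤-Reasoning
    δ = ε Q.* ½
    0<δ : 0ℚ < δ
    0<δ = half-pos 0<ε
    P Q : ℕ → Set
    P n = seq (normSq z) n Q.+ ε ≤ 1ℚ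
    Q n = 0ℚ Q.+ δ Q.* δ ≤ seq (normSq (1ℂ - z)) n
    core : ∀ a b → a Q.* a Q.+ b Q.* b Q.+ ε ≤ 1ℚ →
      0ℚ Q.+ δ Q.* δ ≤ (1ℚ Q.- a) Q.* (1ℚ Q.- a) Q.+ (0ℚ Q.- b) Q.* (0ℚ Q.- b)
    core a b le = begin
      0ℚ Q.+ δ Q.* δ
        ≡⟨ ℚP.+-comm 0ℚ (δ Q.* δ) ⟩
      δ Q.* δ Q.+ 0ℚ
        ≤⟨ ℚP.+-mono-≤
             (*-mono-≤-nonneg {δ} {1ℚ Q.- a} {δ} {1ℚ Q.- a}
               (ℚP.≤-trans (ℚP.<⇒≤ 0<δ) δ≤1-a) (ℚP.<⇒≤ 0<δ) δ≤1-a δ≤1-a)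
             (p*p-nonneg (0ℚ Q.- b)) ⟩
      (1ℚ Q.- a) Q.* (1ℚ Q.- a) Q.+ (0ℚ Q.- b) Q.* (0ℚ Q.- b) ∎
      where
      X = (1ℚ Q.- a) Q.* (1ℚ Q.- a) Q.+ (1ℚ Q.- (a Q.* a Q.+ b Q.* b Q.+ ε)) Q.+ b Q.* b
      0≤X : 0ℚ ≤ X
      0≤X = +-nonneg (+-nonneg (p*p-nonneg (1ℚ Q.- a)) (p≤q⇒0≤q-p le)) (p*p-nonneg b)
      δ≤1-a : δ ≤ 1ℚ Q.- a
      δ≤1-a = ≤-by {δ} (X Q.* ½) (*-nonneg {X} {½} 0≤X (ℚP.<⇒≤ 0<½))
        (solve 3 (λ a b ε → ε :* con ½ :+ ((con 1ℚ :- a) :* (con 1ℚ :- a)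
                    :+ (con 1ℚ :- (a :* a :+ b :* b :+ ε)) :+ b :* b) :* con ½
                    := con 1ℚ :- a) refl a b ε)
    P⇒Q : ∀ n → P n → Q n
    P⇒Q n = core (seq (re z) n) (seq (im z) n)

  1-z≠0 : ∀ z → ∣ z ∣ <ᴿ 1ℝ → 1ℂ - z ≠0
  1-z≠0 z ∣z∣<1 = normSq<1⇒1-z≠0 z (∣z∣<1⇒normSq<1 z ∣z∣<1)

  pochhammer≠0′ : ∀ a q → normSq a <ᴿ 1ℝ → normSq q <ᴿ 1ℝ → ∀ n → pochhammer a q n ≠0
  pochhammer≠0′ a q a<1 q<1 zero = 1ℂ-≠0
  pochhammer≠0′ a q a<1 q<1 (suc n) =
    *-≠0 (pochhammer a q n) (1ℂ - q ^ n * a) (pochhammer≠0′ a q a<1 q<1 n)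
      (normSq<1⇒1-z≠0 (q ^ n * a) (*-≤1-<1 (q ^ n) a (^-≤1 q (<1⇒≤1 q q<1) n) a<1))

  pochhammer≠0 : ∀ q → ∣ q ∣ <ᴿ 1ℝ → ∀ n → pochhammer q q n ≠0
  pochhammer≠0 q ∣q∣<1 = pochhammer≠0′ q q q<1 q<1
    where q<1 = ∣z∣<1⇒normSq<1 q ∣q∣<1

  pochhammer-q*z≠0 : ∀ q z → ∣ q ∣ <ᴿ 1ℝ → ∣ z ∣ <ᴿ 1ℝ → ∀ n → pochhammer (q * z) q n ≠0
  pochhammer-q*z≠0 q z ∣q∣<1 ∣z∣<1 =
    pochhammer≠0′ (q * z) q (*-≤1-<1 q z (<1⇒≤1 q q<1) (∣z∣<1⇒normSq<1 z ∣z∣<1)) q<1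
    where q<1 = ∣z∣<1⇒normSq<1 q ∣q∣<1

open NonVanishing public using (*-≠0; 1-z≠0; pochhammer≠0; pochhammer-q*z≠0)

qBinomial : (q : ℂ) → (∀ k → pochhammer q q k ≠0) → (m k : ℕ) → ℂ
qBinomial q q≠ m k =
  pochhammer q q m / pochhammer q q k * pochhammer q q (m ∸ k)
    ⟨ *-≠0 (pochhammer q q k) (pochhammer q q (m ∸ k)) (q≠ k) (q≠ (m ∸ k)) ⟩

-- hahn q q≠ m α x y is Φ_m^(α)(x, y | q).
hahn : (q : ℂ) → (∀ k → pochhammer q q k ≠0) → ℕ → (α x y : ℂ) → ℂ
hahn q q≠ m α x y =
  ∑< (suc m) (λ k → qBinomial q q≠ m k * pochhammer α q k * x ^ k * y ^ (m ∸ k))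

-- Is₂φ₁ a₁ a₂ b₁ q z q≠ b₁≠ s: the series ₂φ₁(a₁, a₂; b₁; q, z) converges to s.
Is₂φ₁ : (a₁ a₂ b₁ q z : ℂ) →
  (∀ k → pochhammer q q k ≠0) → (∀ k → pochhammer b₁ q k ≠0) → ℂ → Set
Is₂φ₁ a₁ a₂ b₁ q z q≠ b₁≠ = HasSum (λ k →
  (pochhammer a₁ q k * pochhammer a₂ q k)
    / pochhammer q q k * pochhammer b₁ q k
    ⟨ *-≠0 (pochhammer q q k) (pochhammer b₁ q k) (q≠ k) (b₁≠ k) ⟩ * z ^ k)

{-# OPTIONS --safe #-}
-- Put z = xy, t = by and C_k = 1 / (z ; q)_{k+1}. By the q-binomial series,
-- C_k = ∑_j [k+j, k] z^j, so both sides are rearrangements of ∑_k (q^n ; q)_k t^k C_k.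
-- The difference of the N-th partial sums is ∑_{k<N} (q^n ; q)_k t^k R(k, N − k) with R(k, j)
-- the tail of the series of C_k, and q-Pascal gives R(k+1, j+1) = R(k, j+1) + q^{k+1} z R(k+1, j).
-- With |q|, |z|, |t| ≤ r < 1 this yields |R(k, j)| ≤ r^j / ((1 − r) (r ; r)_k), so the
-- difference is O(N r^N).
--
-- A complex number is represented by a sequence of Gaussian rationals on which all operations
-- act termwise, so the identities and estimates are proved for Gaussian rationals, with bounds
-- that do not depend on the index of approximation.
module Submission where

open import Algebra.Bundles using (CommutativeRing)
import Algebra.Solver.Ring.AlmostCommutativeRing as ACR
import Algebra.Solver.Ring.Simple
open import Data.Nat.Base as ℕ using (ℕ; zero; suc; _∸_)
import Data.Nat.Properties as ℕP
open import Data.Product using (_×_; _,_; proj₁; proj₂; ∃; ∃-syntax)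
open import Data.Rational.Base as Q using (ℚ; 0ℚ; 1ℚ; ½)
import Data.Rational.Properties as ℚP
open import Data.Rational.Solver using (module +-*-Solver)
open import Data.Sum using (inj₁; inj₂)
open import Level using (0ℓ)
open import Relation.Binary.Definitions using (DecidableEquality)
open import Relation.Binary.PropositionalEquality
  using (_≡_; refl; sym; trans; cong; cong₂; subst; subst₂; isEquivalence; module ≡-Reasoning)
open import Relation.Nullary using (yes; no; contradiction)
open import Relation.Nullary.Decidable using (map′; _×-dec_)
import Defs

-- Geometric decay over the rationals: Bernoulli's inequality and vanishing sequences.

module Geometric where
  open Q using (_≤_; _<_; _+_; _*_; _-_; positive; nonNegative)
  open +-*-Solver using (solve; _:+_; _:*_; _:-_; _:=_; con)
  open Defs using (Eventually; Eventually-map)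
  open Defs.Rational

  infixr 9 _^_
  _^_ : ℚ → ℕ → ℚ
  p ^ zero  = 1ℚ
  p ^ suc n = p ^ n * p

  ^-nonneg : ∀ {p} → 0ℚ ≤ p → ∀ n → 0ℚ ≤ p ^ n
  ^-nonneg 0≤p zero    = ℚP.<⇒≤ 0<1
  ^-nonneg 0≤p (suc n) = *-nonneg (^-nonneg 0≤p n) 0≤p

  ^-distribˡ-+-* : ∀ p m n → p ^ (m ℕ.+ n) ≡ p ^ m * p ^ n
  ^-distribˡ-+-* p zero    n = sym (ℚP.*-identityˡ (p ^ n))
  ^-distribˡ-+-* p (suc m) n = trans (cong (_* p) (^-distribˡ-+-* p m n))
    (solve 3 (λ a b p → a :* b :* p := a :* p :* b) refl (p ^ m) (p ^ n) p)

  ^-*-distrib : ∀ p q n → (p * q) ^ n ≡ p ^ n * q ^ n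
  ^-*-distrib p q zero    = refl
  ^-*-distrib p q (suc n) = trans (cong (_* (p * q)) (^-*-distrib p q n))
    (solve 4 (λ a b p q → a :* b :* (p :* q) := a :* p :* (b :* q)) refl (p ^ n) (q ^ n) p q)

  ^-monoˡ-≤ : ∀ {p q} → 0ℚ ≤ p → p ≤ q → ∀ n → p ^ n ≤ q ^ n
  ^-monoˡ-≤ 0≤p p≤q zero    = ℚP.≤-refl
  ^-monoˡ-≤ 0≤p p≤q (suc n) = *-mono-≤-nonneg
    (^-nonneg (ℚP.≤-trans 0≤p p≤q) n) 0≤p (^-monoˡ-≤ 0≤p p≤q n) p≤q

  1^n≡1 : ∀ n → 1ℚ ^ n ≡ 1ℚ
  1^n≡1 zero    = refl
  1^n≡1 (suc n) = cong (_* 1ℚ) (1^n≡1 n)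

  ^-≤1 : ∀ {p} → 0ℚ ≤ p → p ≤ 1ℚ → ∀ n → p ^ n ≤ 1ℚ
  ^-≤1 {p} 0≤p p≤1 n = subst (p ^ n ≤_) (1^n≡1 n) (^-monoˡ-≤ 0≤p p≤1 n)

  ^-suc-≤ : ∀ {p} → 0ℚ ≤ p → p ≤ 1ℚ → ∀ n → p ^ suc n ≤ p
  ^-suc-≤ {p} 0≤p p≤1 n = subst (p ^ suc n ≤_) (ℚP.*-identityˡ p)
    (*-mono-≤-nonneg (ℚP.<⇒≤ 0<1) 0≤p (^-≤1 0≤p p≤1 n) ℚP.≤-refl)

  -- This is p^n ≤ 1 / (1 + n(1 - p)) with the denominator cleared. Each induction step widens the
  -- gap to 1 by p^n (1 - p)² (1 + n), which is nonnegative.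
  bernoulli : ∀ {p} → 0ℚ ≤ p → p ≤ 1ℚ → ∀ n → p ^ n * (1ℚ + fromℕ n * (1ℚ - p)) ≤ 1ℚ
  bernoulli {p} 0≤p p≤1 zero    = ℚP.≤-reflexive
    (solve 1 (λ p → con 1ℚ :* (con 1ℚ :+ con 0ℚ :* (con 1ℚ :- p)) := con 1ℚ) refl p)
  bernoulli {p} 0≤p p≤1 (suc n) = ≤-by _
    (+-nonneg (p≤q⇒0≤q-p (bernoulli 0≤p p≤1 n))
      (*-nonneg (^-nonneg 0≤p n) (*-nonneg (p*p-nonneg (1ℚ - p)) (+-nonneg (ℚP.<⇒≤ 0<1) (fromℕ-nonneg n)))))
    (solve 3 (λ p h k → h :* p :* (con 1ℚ :+ (con 1ℚ :+ k) :* (con 1ℚ :- p))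
        :+ ((con 1ℚ :- h :* (con 1ℚ :+ k :* (con 1ℚ :- p)))
            :+ h :* ((con 1ℚ :- p) :* (con 1ℚ :- p) :* (con 1ℚ :+ k))) := con 1ℚ)
      refl p (p ^ n) (fromℕ n))

  -- The Archimedean property yields D with 1 ≤ δ(1 - p)D. For n ≥ D Bernoulli gives p^n (1 - p)D ≤
  -- 1, and the factor (1 - p)D is cancelled.
  ^-vanishes : ∀ {p} → 0ℚ ≤ p → p < 1ℚ → ∀ {δ} → 0ℚ < δ → Eventually (λ n → p ^ n ≤ δ)
  ^-vanishes {p} 0≤p p<1 {δ} 0<δ = proj₁ arch , λ n D≤n →
    ℚP.*-cancelʳ-≤-pos (d * fromℕ D) {{positive (0<dD)}} (begin
      p ^ n * (d * fromℕ D)           ≤⟨ *-mono-≤-nonneg (^-nonneg 0≤p n) 0≤dD ℚP.≤-refl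
                                           (≤-by _ (+-nonneg (ℚP.<⇒≤ 0<1) (*-nonneg (ℚP.<⇒≤ 0<d)
                                             (p≤q⇒0≤q-p (fromℕ-mono D≤n))))
                                             (solve 3 (λ d D n → d :* D :+ (con 1ℚ :+ d :* (n :- D))
                                               := con 1ℚ :+ n :* d) refl d (fromℕ D) (fromℕ n))) ⟩
      p ^ n * (1ℚ + fromℕ n * d)      ≤⟨ bernoulli 0≤p (ℚP.<⇒≤ p<1) n ⟩
      1ℚ                              ≤⟨ proj₂ arch ⟩
      δ * d * fromℕ D                 ≡⟨ ℚP.*-assoc δ d (fromℕ D) ⟩
      δ * (d * fromℕ D)               ∎)
    where
    open ℚP.≤-Reasoning
    d = 1ℚ - p
    0<d : 0ℚ < d
    0<d = p<q⇒0<q-p p<1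
    arch = archimedean (*-pos 0<δ 0<d)
    D = proj₁ arch
    0≤dD : 0ℚ ≤ d * fromℕ D
    0≤dD = *-nonneg (ℚP.<⇒≤ 0<d) (fromℕ-nonneg D)
    0<dD : 0ℚ < d * fromℕ D
    0<dD = ℚP.*-cancelˡ-<-nonNeg δ {{nonNegative (ℚP.<⇒≤ 0<δ)}} (begin-strict
      δ * 0ℚ              ≡⟨ ℚP.*-zeroʳ δ ⟩
      0ℚ                  <⟨ 0<1 ⟩
      1ℚ                  ≤⟨ proj₂ arch ⟩
      δ * d * fromℕ D     ≡⟨ ℚP.*-assoc δ d (fromℕ D) ⟩
      δ * (d * fromℕ D)   ∎)

  ⁻¹-inverseˡ : ∀ {p} → 0ℚ < p → p ⁻¹ * p ≡ 1ℚ
  ⁻¹-inverseˡ {p} 0<p = trans (ℚP.*-comm (p ⁻¹) p) (⁻¹-inverseʳ 0<p)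

  p≤q/d : ∀ {p q d} → 0ℚ < d → p * d ≤ q → p ≤ q * d ⁻¹
  p≤q/d {p} {q} {d} 0<d le = ℚP.*-cancelʳ-≤-pos d {{positive 0<d}} (ℚP.≤-trans le
    (ℚP.≤-reflexive (sym (trans (ℚP.*-assoc q (d ⁻¹) d)
      (trans (cong (q *_) (⁻¹-inverseˡ 0<d)) (ℚP.*-identityʳ q))))))

  -- Splits p ^ n ≤ s ^ n * s ^ n with s = (1 + p) / 2: one factor absorbs n by Bernoulli.
  linear*^-vanishes : ∀ {p} → 0ℚ ≤ p → p < 1ℚ → ∀ {K c} → 0ℚ ≤ K → 0ℚ ≤ c → ∀ {η} → 0ℚ < η →
    Eventually (λ n → K * (fromℕ n + c) * p ^ n ≤ η)
  linear*^-vanishes {p} 0≤p p<1 {K} {c} 0≤K 0≤c {η} 0<η =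
    Eventually-map P⇒Q (^-vanishes {s} 0≤s s<1 {η * L ⁻¹} (*-pos 0<η (⁻¹-pos 0<L)))
    where
    open ℚP.≤-Reasoning
    d = (1ℚ - p) * ½
    s = 1ℚ - d
    0<1-p : 0ℚ < 1ℚ - p
    0<1-p = p<q⇒0<q-p p<1
    0<d : 0ℚ < d
    0<d = half-pos 0<1-p
    s<1 : s < 1ℚ
    s<1 = <-by d 0<d (solve 1 (λ d → con 1ℚ :- d :+ d := con 1ℚ) refl d)
    0≤s : 0ℚ ≤ s
    0≤s = ≤-by ((1ℚ + p) * ½) (*-nonneg (+-nonneg (ℚP.<⇒≤ 0<1) 0≤p) (ℚP.<⇒≤ 0<½))
      (solve 1 (λ p → con 0ℚ :+ (con 1ℚ :+ p) :* con ½ := con 1ℚ :- (con 1ℚ :- p) :* con ½) refl p)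
    -- The arithmetic mean s of 1 and p satisfies s² - p = d².
    p≤s² : p ≤ s * s
    p≤s² = ≤-by (d * d) (p*p-nonneg d)
      (solve 1 (λ p → p :+ (con 1ℚ :- p) :* con ½ :* ((con 1ℚ :- p) :* con ½)
         := (con 1ℚ :- (con 1ℚ :- p) :* con ½) :* (con 1ℚ :- (con 1ℚ :- p) :* con ½)) refl p)
    M L : ℚ
    M = d ⁻¹ + c
    -- The summand 1 keeps `L` invertible when `K` is 0.
    L = K * M + 1ℚ
    0≤M : 0ℚ ≤ M
    0≤M = +-nonneg (ℚP.<⇒≤ (⁻¹-pos 0<d)) 0≤c
    0<L : 0ℚ < L
    0<L = ℚP.+-mono-≤-< (*-nonneg 0≤K 0≤M) 0<1
    absorb : ∀ n → (fromℕ n + c) * s ^ n ≤ M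
    absorb n = begin
      (fromℕ n + c) * h       ≡⟨ ℚP.*-distribʳ-+ h (fromℕ n) c ⟩
      fromℕ n * h + c * h     ≤⟨ ℚP.+-mono-≤ n*h≤d⁻¹
                                   (*-mono-≤-nonneg 0≤c 0≤h ℚP.≤-refl (^-≤1 0≤s (ℚP.<⇒≤ s<1) n)) ⟩
      1ℚ * d ⁻¹ + c * 1ℚ      ≡⟨ cong₂ _+_ (ℚP.*-identityˡ (d ⁻¹)) (ℚP.*-identityʳ c) ⟩
      M                       ∎
      where
      h = s ^ n
      0≤h = ^-nonneg 0≤s n
      n*h≤d⁻¹ : fromℕ n * h ≤ 1ℚ * d ⁻¹
      n*h≤d⁻¹ = p≤q/d 0<d (≤-by _
        (+-nonneg 0≤h (p≤q⇒0≤q-p (bernoulli 0≤s (ℚP.<⇒≤ s<1) n)))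
        (solve 3 (λ n h d → n :* h :* d :+ (h :+
            (con 1ℚ :- h :* (con 1ℚ :+ n :* (con 1ℚ :- (con 1ℚ :- d))))) := con 1ℚ) refl (fromℕ n) h d))
    P⇒Q : ∀ n → s ^ n ≤ η * L ⁻¹ → K * (fromℕ n + c) * p ^ n ≤ η
    P⇒Q n h≤ = begin
      K * (fromℕ n + c) * p ^ n        ≤⟨ *-mono-≤-nonneg 0≤K[n+c] (^-nonneg 0≤p n) ℚP.≤-refl
                                            (ℚP.≤-trans (^-monoˡ-≤ 0≤p p≤s² n)
                                              (ℚP.≤-reflexive (^-*-distrib s s n))) ⟩
      K * (fromℕ n + c) * (h * h)      ≡⟨ solve 3 (λ K m h → K :* m :* (h :* h) := K :* (m :* h) :* h)
                                            refl K (fromℕ n + c) h ⟩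
      K * ((fromℕ n + c) * h) * h      ≤⟨ *-mono-≤-nonneg (*-nonneg 0≤K 0≤M) 0≤h
                                            (*-mono-≤-nonneg 0≤K (*-nonneg 0≤n+c 0≤h) ℚP.≤-refl (absorb n)) h≤ ⟩
      K * M * (η * L ⁻¹)               ≤⟨ *-mono-≤-nonneg (ℚP.<⇒≤ 0<L)
                                            (*-nonneg (ℚP.<⇒≤ 0<η) (ℚP.<⇒≤ (⁻¹-pos 0<L)))
                                            (≤-by {K * M} 1ℚ (ℚP.<⇒≤ 0<1) refl) ℚP.≤-refl ⟩
      L * (η * L ⁻¹)                   ≡⟨ solve 3 (λ L η i → L :* (η :* i) := η :* (L :* i)) refl L η (L ⁻¹) ⟩
      η * (L * L ⁻¹)                   ≡⟨ trans (cong (η *_) (⁻¹-inverseʳ 0<L)) (ℚP.*-identityʳ η) ⟩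
      η                                ∎
      where
      h = s ^ n
      0≤h = ^-nonneg 0≤s n
      0≤n+c = +-nonneg (fromℕ-nonneg n) 0≤c
      0≤K[n+c] = *-nonneg 0≤K 0≤n+c

  -- Bounds for the products 1 / (r ; r)_k and the constants of the error estimate.

  module EulerProduct (r : ℚ) (0≤r : 0ℚ ≤ r) (r<1 : r < 1ℚ) where
    r≤1 : r ≤ 1ℚ
    r≤1 = ℚP.<⇒≤ r<1

    0≤r^ : ∀ k → 0ℚ ≤ r ^ k
    0≤r^ = ^-nonneg 0≤r

    r^suc<1 : ∀ k → r ^ suc k < 1ℚ
    r^suc<1 k = ℚP.≤-<-trans (^-suc-≤ 0≤r r≤1 k) r<1

    -- a k = 1 / (r ; r)_k
    a : ℕ → ℚ
    a zero    = 1ℚ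
    a (suc k) = a k * (1ℚ - r ^ suc k) ⁻¹

    0<1-r^suc : ∀ k → 0ℚ < 1ℚ - r ^ suc k
    0<1-r^suc k = p<q⇒0<q-p (r^suc<1 k)

    0<a : ∀ k → 0ℚ < a k
    0<a zero    = 0<1
    0<a (suc k) = *-pos (0<a k) (⁻¹-pos (0<1-r^suc k))

    0≤a : ∀ k → 0ℚ ≤ a k
    0≤a k = ℚP.<⇒≤ (0<a k)

    a-suc : ∀ k → a (suc k) * (1ℚ - r ^ suc k) ≡ a k
    a-suc k = trans (ℚP.*-assoc (a k) _ _)
      (trans (cong (a k *_) (⁻¹-inverseˡ (0<1-r^suc k))) (ℚP.*-identityʳ (a k)))

    -- The q-Pascal recursion of the tails R(k, j), with r in place of q, holds for `a` with
    -- equality; this lets the bound for the tails reproduce itself under induction.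
    a-pascal : ∀ k → a k + r ^ suc k * a (suc k) ≡ a (suc k)
    a-pascal k = trans (cong (_+ r ^ suc k * a (suc k)) (sym (a-suc k)))
      (solve 2 (λ a h → a :* (con 1ℚ :- h) :+ h :* a := a) refl (a (suc k)) (r ^ suc k))

    a-≤-suc : ∀ k → a k ≤ a (suc k)
    a-≤-suc k = ≤-by _ (*-nonneg (0≤r^ (suc k)) (0≤a (suc k))) (a-pascal k)

    a-≤-+ : ∀ j k → a k ≤ a (j ℕ.+ k)
    a-≤-+ zero    k = ℚP.≤-refl
    a-≤-+ (suc j) k = ℚP.≤-trans (a-≤-+ j k) (a-≤-suc (j ℕ.+ k))

    -- With h = r^(k+1) the left side is a(k+1)(1 - h²). Hence `a` also majorises products of
    -- factors 1 + r^i, which bound the factors of (α ; q)_k.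
    a-*[1+r^]≤ : ∀ k → a k * (1ℚ + r ^ suc k) ≤ a (suc k)
    a-*[1+r^]≤ k = ≤-by (a (suc k) * (r ^ suc k * r ^ suc k))
      (*-nonneg (0≤a (suc k)) (p*p-nonneg (r ^ suc k)))
      (trans (cong (λ x → x * (1ℚ + r ^ suc k) + a (suc k) * (r ^ suc k * r ^ suc k)) (sym (a-suc k)))
        (solve 2 (λ a h → a :* (con 1ℚ :- h) :* (con 1ℚ :+ h) :+ a :* (h :* h) := a)
          refl (a (suc k)) (r ^ suc k)))

    -- Once r ^ k ≤ d = (1 - r) / 2, the quantity a k * (1 + r ^ k / d) no longer increases.
    a-bounded : ∃ λ A → ∀ k → a k ≤ A
    a-bounded = a I * (1ℚ + D * r ^ I) , λ k → begin
      a k                                           ≤⟨ a-≤-+ I k ⟩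
      a (I ℕ.+ k)                                   ≡⟨ cong a (ℕP.+-comm I k) ⟩
      a (k ℕ.+ I)                                   ≤⟨ ≤-by _ (*-nonneg (0≤a (k ℕ.+ I))
                                                         (*-nonneg 0≤D (0≤r^ (k ℕ.+ I))))
                                                         (solve 2 (λ a e → a :+ a :* e := a :* (con 1ℚ :+ e))
                                                           refl (a (k ℕ.+ I)) (D * r ^ (k ℕ.+ I))) ⟩
      a (k ℕ.+ I) * (1ℚ + D * r ^ (k ℕ.+ I))        ≤⟨ decreasing k ⟩
      a I * (1ℚ + D * r ^ I)                        ∎
      where
      open ℚP.≤-Reasoning
      d = (1ℚ - r) * ½
      0<d : 0ℚ < d
      0<d = half-pos (p<q⇒0<q-p r<1)
      D = d ⁻¹
      0≤D : 0ℚ ≤ D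
      0≤D = ℚP.<⇒≤ (⁻¹-pos 0<d)
      small = ^-vanishes 0≤r r<1 0<d
      I = proj₁ small
      step : ∀ k → r ^ k ≤ d → a (suc k) * (1ℚ + D * r ^ suc k) ≤ a k * (1ℚ + D * r ^ k)
      step k u≤d = subst (λ x → a (suc k) * (1ℚ + D * r ^ suc k) ≤ x * (1ℚ + D * r ^ k)) (a-suc k)
        (subst (a (suc k) * (1ℚ + D * (u * r)) ≤_) (sym (ℚP.*-assoc (a (suc k)) (1ℚ - u * r) (1ℚ + D * u)))
          (*-mono-≤-nonneg (0≤a (suc k))
            (+-nonneg (ℚP.<⇒≤ 0<1) (*-nonneg 0≤D (*-nonneg 0≤u 0≤r))) ℚP.≤-refl core))
        where
        u = r ^ k
        0≤u = 0≤r^ k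
        -- Since D d = 1, right side minus left side is u((1 - r) + D(d - u) + D u (1 - r)), a sum
        -- of nonnegative terms.
        core : 1ℚ + D * (u * r) ≤ (1ℚ - u * r) * (1ℚ + D * u)
        core = ≤-by (u * (D * (d + (d - u) + u * (1ℚ - r)) - r))
          (*-nonneg 0≤u (subst (λ x → 0ℚ ≤ x - r)
            (trans (cong (_+ D * (d - u + u * (1ℚ - r))) (sym (⁻¹-inverseˡ 0<d)))
              (solve 4 (λ D d u e → D :* d :+ D :* (d :- u :+ u :* e) := D :* (d :+ (d :- u) :+ u :* e))
                refl D d u (1ℚ - r)))
            (subst (0ℚ ≤_) (solve 2 (λ r e → con 1ℚ :- r :+ e := con 1ℚ :+ e :- r)
                refl r (D * (d - u + u * (1ℚ - r))))
              (+-nonneg (p≤q⇒0≤q-p r≤1) (*-nonneg 0≤D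
                (+-nonneg (p≤q⇒0≤q-p u≤d) (*-nonneg 0≤u (p≤q⇒0≤q-p r≤1))))))))
          (solve 3 (λ D u r → con 1ℚ :+ D :* (u :* r) :+ u :* (D :* ((con 1ℚ :- r) :* con ½
                :+ ((con 1ℚ :- r) :* con ½ :- u) :+ u :* (con 1ℚ :- r)) :- r)
              := (con 1ℚ :- u :* r) :* (con 1ℚ :+ D :* u)) refl D u r)
      decreasing : ∀ k → a (k ℕ.+ I) * (1ℚ + D * r ^ (k ℕ.+ I)) ≤ a I * (1ℚ + D * r ^ I)
      decreasing zero    = ℚP.≤-refl
      decreasing (suc k) = ℚP.≤-trans (step (k ℕ.+ I) (proj₂ small (k ℕ.+ I) (ℕP.m≤n+m I k))) (decreasing k)

    -- `κ` is the sum of the geometric series of r. `K` multiplies the bound 2A for (α ; q)_k by the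
    -- bound κA for 1 / (z ; q)_{k+1}.
    κ A K : ℚ
    κ = (1ℚ - r) ⁻¹
    A = proj₁ a-bounded
    K = ((1ℚ + 1ℚ) * A) * (κ * A)

    0<κ : 0ℚ < κ
    0<κ = ⁻¹-pos (p<q⇒0<q-p r<1)

    0≤κ : 0ℚ ≤ κ
    0≤κ = ℚP.<⇒≤ 0<κ

    a≤A : ∀ k → a k ≤ A
    a≤A = proj₂ a-bounded

    1≤A : 1ℚ ≤ A
    1≤A = a≤A 0

    0≤A : 0ℚ ≤ A
    0≤A = ℚP.≤-trans (ℚP.<⇒≤ 0<1) 1≤A

    0≤2 : 0ℚ ≤ 1ℚ + 1ℚ
    0≤2 = +-nonneg (ℚP.<⇒≤ 0<1) (ℚP.<⇒≤ 0<1)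

    0≤K : 0ℚ ≤ K
    0≤K = *-nonneg (*-nonneg 0≤2 0≤A) (*-nonneg 0≤κ 0≤A)

    2*-mono : ∀ {x y} → 0ℚ ≤ x → x ≤ y → (1ℚ + 1ℚ) * x ≤ (1ℚ + 1ℚ) * y
    2*-mono 0≤x x≤y = *-mono-≤-nonneg 0≤2 0≤x ℚP.≤-refl x≤y

    -- One bound serves two estimates: half of it covers K N r^N + K κ r^N, and the factor 2 also
    -- covers |1 - z| in `U-tail`.
    error : ℕ → ℚ
    error N = (1ℚ + 1ℚ) * K * (fromℕ N + κ) * r ^ N

    error-vanishes : ∀ {η} → 0ℚ < η → Eventually (λ N → error N ≤ η)
    error-vanishes = linear*^-vanishes 0≤r r<1 (*-nonneg 0≤2 0≤K) 0≤κ

-- Gaussian rationals: ring structure, inverses and bounds on the modulus.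

module Gaussian where
  open Q using (_≤_; _<_; positive; nonNegative)
  open +-*-Solver using (solve; _:+_; _:*_; _:-_; :-_; _:=_; con)
  open Defs.Rational

  infixl 6 _+_ _-_
  infixl 7 _*_
  infix  8 -_
  infixr 9 _^_
  infix  9 _⁻¹ᴳ
  infix  4 _≼_

  -- A data type rather than a record, so that operations on variables stay folded.
  data 𝔾 : Set where
    _⊕_ : ℚ → ℚ → 𝔾

  0# 1# : 𝔾
  0# = 0ℚ ⊕ 0ℚ
  1# = 1ℚ ⊕ 0ℚ

  _+_ _*_ : 𝔾 → 𝔾 → 𝔾
  (a ⊕ b) + (c ⊕ d) = (a Q.+ c) ⊕ (b Q.+ d)
  (a ⊕ b) * (c ⊕ d) = (a Q.* c Q.+ Q.- (b Q.* d)) ⊕ (a Q.* d Q.+ b Q.* c)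

  -_ : 𝔾 → 𝔾
  - (a ⊕ b) = (Q.- a) ⊕ (Q.- b)

  _-_ : 𝔾 → 𝔾 → 𝔾
  z - w = z + - w

  normSq : 𝔾 → ℚ
  normSq (a ⊕ b) = a Q.* a Q.+ b Q.* b

  -- Conjugate over squared norm, total because `_⁻¹` sends 0 to 0. Division of complex numbers uses
  -- exactly this formula termwise.
  _⁻¹ᴳ : 𝔾 → 𝔾
  (a ⊕ b) ⁻¹ᴳ = (a Q.* n) ⊕ (Q.- b Q.* n)
    where n = (a Q.* a Q.+ b Q.* b) ⁻¹

  _^_ : 𝔾 → ℕ → 𝔾
  z ^ zero  = 1#
  z ^ suc n = z ^ n * z

  re im : 𝔾 → ℚ
  re (a ⊕ b) = a
  im (a ⊕ b) = b

  _≟_ : DecidableEquality 𝔾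
  (a ⊕ b) ≟ (c ⊕ d) = map′ (λ { (refl , refl) → refl }) (λ { refl → refl , refl })
    (a ℚP.≟ c ×-dec b ℚP.≟ d)

  +-assoc : ∀ x y z → (x + y) + z ≡ x + (y + z)
  +-assoc (a ⊕ b) (c ⊕ d) (e ⊕ f) = cong₂ _⊕_ (ℚP.+-assoc a c e) (ℚP.+-assoc b d f)

  +-comm : ∀ x y → x + y ≡ y + x
  +-comm (a ⊕ b) (c ⊕ d) = cong₂ _⊕_ (ℚP.+-comm a c) (ℚP.+-comm b d)

  +-identityˡ : ∀ x → 0# + x ≡ x
  +-identityˡ (a ⊕ b) = cong₂ _⊕_ (ℚP.+-identityˡ a) (ℚP.+-identityˡ b)

  +-identityʳ : ∀ x → x + 0# ≡ x
  +-identityʳ (a ⊕ b) = cong₂ _⊕_ (ℚP.+-identityʳ a) (ℚP.+-identityʳ b)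

  -‿inverseˡ : ∀ x → - x + x ≡ 0#
  -‿inverseˡ (a ⊕ b) = cong₂ _⊕_ (ℚP.+-inverseˡ a) (ℚP.+-inverseˡ b)

  -‿inverseʳ : ∀ x → x + - x ≡ 0#
  -‿inverseʳ (a ⊕ b) = cong₂ _⊕_ (ℚP.+-inverseʳ a) (ℚP.+-inverseʳ b)

  *-assoc : ∀ x y z → (x * y) * z ≡ x * (y * z)
  *-assoc (a ⊕ b) (c ⊕ d) (e ⊕ f) = cong₂ _⊕_
    (solve 6 (λ a b c d e f → (a :* c :+ :- (b :* d)) :* e :+ :- ((a :* d :+ b :* c) :* f)
      := a :* (c :* e :+ :- (d :* f)) :+ :- (b :* (c :* f :+ d :* e))) refl a b c d e f)
    (solve 6 (λ a b c d e f → (a :* c :+ :- (b :* d)) :* f :+ (a :* d :+ b :* c) :* e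
      := a :* (c :* f :+ d :* e) :+ b :* (c :* e :+ :- (d :* f))) refl a b c d e f)

  *-comm : ∀ x y → x * y ≡ y * x
  *-comm (a ⊕ b) (c ⊕ d) = cong₂ _⊕_
    (solve 4 (λ a b c d → a :* c :+ :- (b :* d) := c :* a :+ :- (d :* b)) refl a b c d)
    (solve 4 (λ a b c d → a :* d :+ b :* c := c :* b :+ d :* a) refl a b c d)

  *-identityˡ : ∀ x → 1# * x ≡ x
  *-identityˡ (a ⊕ b) = cong₂ _⊕_
    (solve 2 (λ a b → con 1ℚ :* a :+ :- (con 0ℚ :* b) := a) refl a b)
    (solve 2 (λ a b → con 1ℚ :* b :+ con 0ℚ :* a := b) refl a b)

  *-identityʳ : ∀ x → x * 1# ≡ x
  *-identityʳ x = trans (*-comm x 1#) (*-identityˡ x)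

  *-distribˡ-+ : ∀ x y z → x * (y + z) ≡ x * y + x * z
  *-distribˡ-+ (a ⊕ b) (c ⊕ d) (e ⊕ f) = cong₂ _⊕_
    (solve 6 (λ a b c d e f → a :* (c :+ e) :+ :- (b :* (d :+ f))
      := (a :* c :+ :- (b :* d)) :+ (a :* e :+ :- (b :* f))) refl a b c d e f)
    (solve 6 (λ a b c d e f → a :* (d :+ f) :+ b :* (c :+ e)
      := (a :* d :+ b :* c) :+ (a :* f :+ b :* e)) refl a b c d e f)

  *-distribʳ-+ : ∀ x y z → (y + z) * x ≡ y * x + z * x
  *-distribʳ-+ x y z = trans (*-comm (y + z) x)
    (trans (*-distribˡ-+ x y z) (cong₂ _+_ (*-comm x y) (*-comm x z)))

  +-*-commutativeRing : CommutativeRing 0ℓ 0ℓ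
  +-*-commutativeRing = record
    { Carrier = 𝔾 ; _≈_ = _≡_ ; _+_ = _+_ ; _*_ = _*_ ; -_ = -_ ; 0# = 0# ; 1# = 1#
    ; isCommutativeRing = record
      { isRing = record
        { +-isAbelianGroup = record
          { isGroup = record
            { isMonoid = record
              { isSemigroup = record
                { isMagma = record { isEquivalence = isEquivalence ; ∙-cong = cong₂ _+_ }
                ; assoc = +-assoc }
              ; identity = +-identityˡ , +-identityʳ }
            ; inverse = -‿inverseˡ , -‿inverseʳ
            ; ⁻¹-cong = cong (λ z → - z) }
          ; comm = +-comm }
        ; *-cong = cong₂ _*_
        ; *-assoc = *-assoc
        ; *-identity = *-identityˡ , *-identityʳ
        ; distrib = *-distribˡ-+ , *-distribʳ-+ }
      ; *-comm = *-comm } }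

  module 𝔾-Solver = Algebra.Solver.Ring.Simple (ACR.fromCommutativeRing +-*-commutativeRing) _≟_

  normSq-nonneg : ∀ z → 0ℚ ≤ normSq z
  normSq-nonneg (a ⊕ b) = +-nonneg (p*p-nonneg a) (p*p-nonneg b)

  normSq-* : ∀ z w → normSq (z * w) ≡ normSq z Q.* normSq w
  normSq-* (a ⊕ b) (c ⊕ d) = solve 4 (λ a b c d →
      (a :* c :+ :- (b :* d)) :* (a :* c :+ :- (b :* d)) :+ (a :* d :+ b :* c) :* (a :* d :+ b :* c)
      := (a :* a :+ b :* b) :* (c :* c :+ d :* d)) refl a b c d

  *-inverseʳ : ∀ z → 0ℚ < normSq z → z * z ⁻¹ᴳ ≡ 1#
  *-inverseʳ (a ⊕ b) 0<n = cong₂ _⊕_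
    (trans (solve 3 (λ a b n → a :* (a :* n) :+ :- (b :* (:- b :* n)) := (a :* a :+ b :* b) :* n)
      refl a b (normSq (a ⊕ b) ⁻¹)) (⁻¹-inverseʳ 0<n))
    (solve 3 (λ a b n → a :* (:- b :* n) :+ b :* (a :* n) := con 0ℚ) refl a b (normSq (a ⊕ b) ⁻¹))

  square-cancel-≤ : ∀ {p q} → 0ℚ ≤ q → p Q.* p ≤ q Q.* q → p ≤ q
  square-cancel-≤ {p} {q} 0≤q p²≤q² with p ℚP.≤? q
  ... | yes p≤q = p≤q
  ... | no p≰q = contradiction refl (ℚP.<⇒≢ (ℚP.<-≤-trans q²<p² p²≤q²))
    where
    q<p : q < p
    q<p = ℚP.≰⇒> p≰q
    q²<p² : q Q.* q < p Q.* p
    q²<p² = ℚP.≤-<-trans (*-mono-≤-nonneg 0≤q 0≤q ℚP.≤-refl (ℚP.<⇒≤ q<p))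
      (ℚP.*-monoˡ-<-pos p {{positive (ℚP.≤-<-trans 0≤q q<p)}} q<p)

  -- Encodes |z| ≤ p by squares, because the modulus of a Gaussian rational need not be rational.
  record _≼_ (z : 𝔾) (p : ℚ) : Set where
    constructor bound
    field
      nonneg : 0ℚ ≤ p
      normSq≤ : normSq z ≤ p Q.* p
  open _≼_ public

  ≼-mono : ∀ {z p q} → z ≼ p → p ≤ q → z ≼ q
  ≼-mono (bound 0≤p le) p≤q = bound (ℚP.≤-trans 0≤p p≤q)
    (ℚP.≤-trans le (*-mono-≤-nonneg (ℚP.≤-trans 0≤p p≤q) 0≤p p≤q p≤q))

  0≼ : ∀ {p} → 0ℚ ≤ p → 0# ≼ p
  0≼ {p} 0≤p = bound 0≤p (p*p-nonneg p)

  1≼1 : 1# ≼ 1ℚ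
  1≼1 = bound (ℚP.<⇒≤ 0<1) ℚP.≤-refl

  ≼-neg : ∀ {z p} → z ≼ p → - z ≼ p
  ≼-neg {a ⊕ b} {p} (bound 0≤p le) = bound 0≤p (subst (_≤ p Q.* p)
    (solve 2 (λ a b → a :* a :+ b :* b := :- a :* :- a :+ :- b :* :- b) refl a b) le)

  ≼-* : ∀ {z w p q} → z ≼ p → w ≼ q → z * w ≼ p Q.* q
  ≼-* {z} {w} {p} {q} (bound 0≤p z≤) (bound 0≤q w≤) = bound (*-nonneg 0≤p 0≤q)
    (subst₂ _≤_ (sym (normSq-* z w))
      (solve 2 (λ p q → p :* p :* (q :* q) := p :* q :* (p :* q)) refl p q)
      (*-mono-≤-nonneg (p*p-nonneg p) (normSq-nonneg w) z≤ w≤))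

  -- Lagrange's identity: (ac + bd)² + (ad - bc)² = (a² + b²)(c² + d²).
  cauchy-schwarz : ∀ {a b c d p q} → 0ℚ ≤ p → 0ℚ ≤ q →
    a Q.* a Q.+ b Q.* b ≤ p Q.* p → c Q.* c Q.+ d Q.* d ≤ q Q.* q → a Q.* c Q.+ b Q.* d ≤ p Q.* q
  cauchy-schwarz {a} {b} {c} {d} {p} {q} 0≤p 0≤q le le′ = square-cancel-≤ (*-nonneg 0≤p 0≤q)
    (ℚP.≤-trans
      (≤-by _ (p*p-nonneg (a Q.* d Q.- b Q.* c))
        (solve 4 (λ a b c d → (a :* c :+ b :* d) :* (a :* c :+ b :* d)
            :+ (a :* d :- b :* c) :* (a :* d :- b :* c)
            := (a :* a :+ b :* b) :* (c :* c :+ d :* d)) refl a b c d))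
      (ℚP.≤-trans (*-mono-≤-nonneg (p*p-nonneg p) (normSq-nonneg (c ⊕ d)) le le′)
        (ℚP.≤-reflexive (solve 2 (λ p q → p :* p :* (q :* q) := p :* q :* (p :* q)) refl p q))))

  -- The cross term 2(ac + bd) of |z + w|² is at most 2pq by Cauchy-Schwarz.
  ≼-+ : ∀ {z w p q} → z ≼ p → w ≼ q → z + w ≼ p Q.+ q
  ≼-+ {a ⊕ b} {c ⊕ d} {p} {q} (bound 0≤p le) (bound 0≤q le′) = bound (+-nonneg 0≤p 0≤q)
    (≤-by _ (+-nonneg (+-nonneg (p≤q⇒0≤q-p le) (p≤q⇒0≤q-p le′)) (+-nonneg 0≤cs 0≤cs))
      (solve 6 (λ a b c d p q → (a :+ c) :* (a :+ c) :+ (b :+ d) :* (b :+ d)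
          :+ ((p :* p :- (a :* a :+ b :* b)) :+ (q :* q :- (c :* c :+ d :* d))
             :+ ((p :* q :- (a :* c :+ b :* d)) :+ (p :* q :- (a :* c :+ b :* d))))
          := (p :+ q) :* (p :+ q)) refl a b c d p q))
    where
    0≤cs : 0ℚ ≤ p Q.* q Q.- (a Q.* c Q.+ b Q.* d)
    0≤cs = p≤q⇒0≤q-p (cauchy-schwarz {a} {b} {c} {d} 0≤p 0≤q le le′)

  ≼-- : ∀ {z w p q} → z ≼ p → w ≼ q → z - w ≼ p Q.+ q
  ≼-- z≼p w≼q = ≼-+ z≼p (≼-neg w≼q)

  ≼-^ : ∀ {z p} → z ≼ p → ∀ n → z ^ n ≼ p Geometric.^ n
  ≼-^ z≼p zero    = 1≼1
  ≼-^ z≼p (suc n) = ≼-* (≼-^ z≼p n) z≼p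

  ≼⇒∣re∣≤ : ∀ {z p} → z ≼ p → Q.∣ re z ∣ ≤ p
  ≼⇒∣im∣≤ : ∀ {z p} → z ≼ p → Q.∣ im z ∣ ≤ p

  ∣p∣²≡p² : ∀ p → Q.∣ p ∣ Q.* Q.∣ p ∣ ≡ p Q.* p
  ∣p∣²≡p² p = trans (sym (ℚP.∣p*q∣≡∣p∣*∣q∣ p p)) (ℚP.0≤p⇒∣p∣≡p (p*p-nonneg p))

  ≼⇒∣re∣≤ {a ⊕ b} {p} (bound 0≤p le) = square-cancel-≤ 0≤p (subst (_≤ p Q.* p) (sym (∣p∣²≡p² a))
    (ℚP.≤-trans (≤-by _ (p*p-nonneg b) refl) le))
  ≼⇒∣im∣≤ {a ⊕ b} {p} (bound 0≤p le) = square-cancel-≤ 0≤p (subst (_≤ p Q.* p) (sym (∣p∣²≡p² b))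
    (ℚP.≤-trans (≤-by _ (p*p-nonneg a) (ℚP.+-comm (b Q.* b) (a Q.* a))) le))

  -- The real part of 1 - z is at least 1 - p, and the square of the imaginary part only adds to the
  -- norm.
  1-z-normSq : ∀ {z p} → z ≼ p → p < 1ℚ → (1ℚ Q.- p) Q.* (1ℚ Q.- p) ≤ normSq (1# - z)
  1-z-normSq {a ⊕ b} {p} z≼p p<1 = ℚP.≤-trans
    (*-mono-≤-nonneg (ℚP.≤-trans 0≤1-p 1-p≤1-a) 0≤1-p 1-p≤1-a 1-p≤1-a)
    (≤-by _ (p*p-nonneg (0ℚ Q.+ Q.- b)) refl)
    where
    0≤1-p : 0ℚ ≤ 1ℚ Q.- p
    0≤1-p = p≤q⇒0≤q-p (ℚP.<⇒≤ p<1)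
    1-p≤1-a : 1ℚ Q.- p ≤ 1ℚ Q.- a
    1-p≤1-a = ℚP.+-monoʳ-≤ 1ℚ (ℚP.neg-antimono-≤ (ℚP.≤-trans (p≤∣p∣ a) (≼⇒∣re∣≤ z≼p)))

  1-z-positive : ∀ {z p} → z ≼ p → p < 1ℚ → 0ℚ < normSq (1# - z)
  1-z-positive z≼p p<1 = ℚP.<-≤-trans (*-pos (p<q⇒0<q-p p<1) (p<q⇒0<q-p p<1)) (1-z-normSq z≼p p<1)

  1-z-inverseʳ : ∀ {z p} → z ≼ p → p < 1ℚ → (1# - z) * (1# - z) ⁻¹ᴳ ≡ 1#
  1-z-inverseʳ {z} z≼p p<1 = *-inverseʳ (1# - z) (1-z-positive z≼p p<1)

  -- The squared norms of 1 - z and its inverse multiply to 1, and the first is at least d². The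
  -- chain inserts 1 = (d i)² to turn this into a bound by i².
  1-z⁻¹≼ : ∀ {z p} → z ≼ p → p < 1ℚ → (1# - z) ⁻¹ᴳ ≼ (1ℚ Q.- p) ⁻¹
  1-z⁻¹≼ {z} {p} z≼p p<1 = bound 0≤i (begin
    normSq u                          ≡⟨ sym (ℚP.*-identityʳ (normSq u)) ⟩
    normSq u Q.* 1ℚ                   ≡⟨ cong (normSq u Q.*_) (sym (cong₂ Q._*_ (⁻¹-inverseʳ 0<d) (⁻¹-inverseʳ 0<d))) ⟩
    normSq u Q.* (d Q.* i Q.* (d Q.* i))
                                      ≡⟨ solve 3 (λ u d i → u :* (d :* i :* (d :* i)) := d :* d :* u :* (i :* i)) refl (normSq u) d i ⟩
    d Q.* d Q.* normSq u Q.* (i Q.* i)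
                                      ≤⟨ *-mono-≤-nonneg (ℚP.<⇒≤ 0<1) (p*p-nonneg i) lem ℚP.≤-refl ⟩
    1ℚ Q.* (i Q.* i)                  ≡⟨ ℚP.*-identityˡ (i Q.* i) ⟩
    i Q.* i                           ∎)
    where
    open ℚP.≤-Reasoning
    u = (1# - z) ⁻¹ᴳ
    d = 1ℚ Q.- p
    i = d ⁻¹
    0<d : 0ℚ < d
    0<d = p<q⇒0<q-p p<1
    0≤i : 0ℚ ≤ i
    0≤i = ℚP.<⇒≤ (⁻¹-pos 0<d)
    lem : d Q.* d Q.* normSq u ≤ 1ℚ
    lem = begin
      d Q.* d Q.* normSq u           ≤⟨ *-mono-≤-nonneg (normSq-nonneg (1# - z)) (normSq-nonneg u)
                                          (1-z-normSq z≼p p<1) ℚP.≤-refl ⟩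
      normSq (1# - z) Q.* normSq u   ≡⟨ sym (normSq-* (1# - z) u) ⟩
      normSq ((1# - z) * u)          ≡⟨ cong normSq (1-z-inverseʳ z≼p p<1) ⟩
      1ℚ                             ∎

-- Finite sums, q-shifted factorials and Hahn polynomials over the Gaussian rationals.

module GaussianSeries where
  open Q using (_≤_; _<_)
  open Defs.Rational
  open Gaussian
  open 𝔾-Solver using (solve; _:+_; _:*_; _:-_; :-_; _:=_; con)
  open ≡-Reasoning
  private module ℚS = +-*-Solver

  ∑ : ℕ → (ℕ → 𝔾) → 𝔾
  ∑ zero    f = 0#
  ∑ (suc n) f = ∑ n f + f n

  ∑-cong : ∀ {f g} n → (∀ k → k ℕ.< n → f k ≡ g k) → ∑ n f ≡ ∑ n g
  ∑-cong zero    f≡g = refl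
  ∑-cong (suc n) f≡g =
    cong₂ _+_ (∑-cong n (λ k k<n → f≡g k (ℕP.m≤n⇒m≤1+n k<n))) (f≡g n ℕP.≤-refl)

  *-distribˡ-∑ : ∀ c f n → c * ∑ n f ≡ ∑ n (λ k → c * f k)
  *-distribˡ-∑ c f zero    = solve 1 (λ c → c :* con 0# := con 0#) refl c
  *-distribˡ-∑ c f (suc n) = trans (*-distribˡ-+ c (∑ n f) (f n))
    (cong (_+ c * f n) (*-distribˡ-∑ c f n))

  ∑-distrib-- : ∀ f g n → ∑ n (λ k → f k - g k) ≡ ∑ n f - ∑ n g
  ∑-distrib-- f g zero    = refl
  ∑-distrib-- f g (suc n) = trans (cong (_+ (f n - g n)) (∑-distrib-- f g n))
    (solve 4 (λ F G f g → F :- G :+ (f :- g) := (F :+ f) :- (G :+ g)) refl (∑ n f) (∑ n g) (f n) (g n))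

  ∑-≼ : ∀ {f p} n → 0ℚ ≤ p → (∀ k → k ℕ.< n → f k ≼ p) → ∑ n f ≼ fromℕ n Q.* p
  ∑-≼ {p = p} zero    0≤p f≼p = 0≼ (ℚP.≤-reflexive (sym (ℚP.*-zeroˡ p)))
  ∑-≼ {f} {p} (suc n) 0≤p f≼p = subst (∑ n f + f n ≼_)
    (trans (ℚP.+-comm (fromℕ n Q.* p) p) (trans (cong (Q._+ fromℕ n Q.* p) (sym (ℚP.*-identityˡ p)))
      (sym (ℚP.*-distribʳ-+ p 1ℚ (fromℕ n)))))
    (≼-+ (∑-≼ n 0≤p (λ k k<n → f≼p k (ℕP.m≤n⇒m≤1+n k<n))) (f≼p n ℕP.≤-refl))

  ^-distribˡ-+-* : ∀ z m n → z ^ (m ℕ.+ n) ≡ z ^ m * z ^ n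
  ^-distribˡ-+-* z zero    n = sym (*-identityˡ (z ^ n))
  ^-distribˡ-+-* z (suc m) n = trans (cong (_* z) (^-distribˡ-+-* z m n))
    (solve 3 (λ a b z → a :* b :* z := a :* z :* b) refl (z ^ m) (z ^ n) z)

  ^-*-distrib : ∀ z w n → (z * w) ^ n ≡ z ^ n * w ^ n
  ^-*-distrib z w zero    = refl
  ^-*-distrib z w (suc n) = trans (cong (_* (z * w)) (^-*-distrib z w n))
    (solve 4 (λ a b z w → a :* b :* (z :* w) := a :* z :* (b :* w)) refl (z ^ n) (w ^ n) z w)

  poch : 𝔾 → 𝔾 → ℕ → 𝔾
  poch a q zero    = 1#
  poch a q (suc n) = poch a q n * (1# - q ^ n * a)

  qBinomial : 𝔾 → ℕ → ℕ → 𝔾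
  qBinomial q m k = poch q q m * (poch q q k * poch q q (m ∸ k)) ⁻¹ᴳ

  hahn : 𝔾 → ℕ → 𝔾 → 𝔾 → 𝔾 → 𝔾
  hahn q m α x y = ∑ (suc m) (λ k → qBinomial q m k * poch α q k * x ^ k * y ^ (m ∸ k))

  φ-term : 𝔾 → 𝔾 → 𝔾 → 𝔾 → 𝔾 → ℕ → 𝔾
  φ-term a₁ a₂ b₁ q z k =
    poch a₁ q k * poch a₂ q k * (poch q q k * poch b₁ q k) ⁻¹ᴳ * z ^ k

  -- The rearrangement and its estimates for fixed parameters, with α in place of q^n.

  module Kernel (q z t α : 𝔾) (r : ℚ) (0≤r : 0ℚ ≤ r) (r<1 : r < 1ℚ)
    (q≼r : q ≼ r) (z≼r : z ≼ r) (t≼r : t ≼ r) (α≼1 : α ≼ 1ℚ) where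

    open Geometric.EulerProduct r 0≤r r<1
    open Geometric using () renaming (_^_ to _^ℚ_)

    c : 𝔾
    c = (1# - z) ⁻¹ᴳ

    -- C k = 1 / (z ; q)_{k+1}
    C : ℕ → 𝔾
    C zero    = c
    C (suc k) = C k * (1# - q ^ suc k * z) ⁻¹ᴳ

    -- bin k j is the q-binomial coefficient [ k + j , k ], defined by q-Pascal.
    bin : ℕ → ℕ → 𝔾
    bin k       zero    = 1#
    bin zero    (suc j) = 1#
    bin (suc k) (suc j) = bin k (suc j) + q ^ suc k * bin (suc k) j

    -- The factorial formula for the q-binomial coefficient, multiplied out. With h = q^(k+1) and g
    -- = q^(j+1), the induction rests on (1 - h) + h(1 - g) = 1 - hg.
    bin-poch : ∀ k j → bin k j * (poch q q k * poch q q j) ≡ poch q q (k ℕ.+ j)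
    bin-poch k zero = trans (solve 1 (λ x → con 1# :* (x :* con 1#) := x) refl (poch q q k))
      (cong (poch q q) (sym (ℕP.+-identityʳ k)))
    bin-poch zero (suc j) =
      solve 1 (λ x → con 1# :* (con 1# :* x) := x) refl (poch q q (suc j))
    bin-poch (suc k) (suc j) = begin
      (B₁ + h * B₂) * (X * (1# - h) * (Y * (1# - g)))
        ≡⟨ solve 6 (λ B₁ B₂ X Y h g → (B₁ :+ h :* B₂) :* (X :* (con 1# :- h) :* (Y :* (con 1# :- g)))
             := B₁ :* (X :* (Y :* (con 1# :- g))) :* (con 1# :- h)
                :+ h :* (B₂ :* (X :* (con 1# :- h) :* Y)) :* (con 1# :- g)) refl B₁ B₂ X Y h g ⟩
      B₁ * (X * (Y * (1# - g))) * (1# - h) + h * (B₂ * (X * (1# - h) * Y)) * (1# - g)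
        ≡⟨ cong₂ (λ u v → u * (1# - h) + h * v * (1# - g)) (bin-poch k (suc j))
             (trans (bin-poch (suc k) j) (cong (poch q q) (sym (ℕP.+-suc k j)))) ⟩
      P * (1# - h) + h * P * (1# - g)
        ≡⟨ solve 4 (λ P a g q → P :* (con 1# :- a :* q) :+ a :* q :* P :* (con 1# :- g)
             := P :* (con 1# :- a :* g :* q)) refl P (q ^ k) g q ⟩
      P * (1# - q ^ k * g * q)
        ≡⟨ cong (λ u → P * (1# - u * q)) (sym (^-distribˡ-+-* q k (suc j))) ⟩
      P * (1# - q ^ (k ℕ.+ suc j) * q) ∎
      where
      B₁ = bin k (suc j)
      B₂ = bin (suc k) j
      X = poch q q k
      Y = poch q q j
      h = q ^ suc k
      g = q ^ suc j
      P = poch q q (k ℕ.+ suc j)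

    z≼1 : z ≼ 1ℚ
    z≼1 = ≼-mono z≼r r≤1

    q^k*w≼ : ∀ {w} → w ≼ 1ℚ → ∀ k → q ^ k * w ≼ r ^ℚ k
    q^k*w≼ {w} w≼1 k = subst (q ^ k * w ≼_) (ℚP.*-identityʳ (r ^ℚ k)) (≼-* (≼-^ q≼r k) w≼1)

    poch-positive : ∀ w → w ≼ r → ∀ k → 0ℚ < normSq (poch w q k)
    poch-positive w w≼r zero    = 0<1
    poch-positive w w≼r (suc k) = subst (0ℚ <_) (sym (normSq-* (poch w q k) (1# - q ^ k * w)))
      (*-pos (poch-positive w w≼r k)
        (1-z-positive (≼-* (≼-^ q≼r k) w≼r) (r^suc<1 k)))

    poch-poch-inverse : ∀ v w → v ≼ r → w ≼ r → ∀ j k →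
      poch v q j * poch w q k * (poch v q j * poch w q k) ⁻¹ᴳ ≡ 1#
    poch-poch-inverse v w v≼r w≼r j k = *-inverseʳ _
      (subst (0ℚ <_) (sym (normSq-* (poch v q j) (poch w q k)))
        (*-pos (poch-positive v v≼r j) (poch-positive w w≼r k)))

    qBinomial≡bin : ∀ m k → k ℕ.≤ m → qBinomial q m k ≡ bin k (m ∸ k)
    qBinomial≡bin m k k≤m = begin
      poch q q m * W ⁻¹ᴳ             ≡⟨ cong (λ i → poch q q i * W ⁻¹ᴳ) (sym (ℕP.m+[n∸m]≡n k≤m)) ⟩
      poch q q (k ℕ.+ j) * W ⁻¹ᴳ     ≡⟨ cong (_* W ⁻¹ᴳ) (sym (bin-poch k j)) ⟩
      bin k j * W * W ⁻¹ᴳ            ≡⟨ *-assoc (bin k j) W (W ⁻¹ᴳ) ⟩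
      bin k j * (W * W ⁻¹ᴳ)          ≡⟨ cong (bin k j *_) (poch-poch-inverse q q q≼r q≼r k j) ⟩
      bin k j * 1#                   ≡⟨ *-identityʳ (bin k j) ⟩
      bin k j                        ∎
      where
      j = m ∸ k
      W = poch q q k * poch q q j

    c-inverse : (1# - z) * c ≡ 1#
    c-inverse = 1-z-inverseʳ z≼r r<1

    C-suc : ∀ k → C (suc k) * (1# - q ^ suc k * z) ≡ C k
    C-suc k = begin
      C k * u ⁻¹ᴳ * u      ≡⟨ solve 3 (λ C i u → C :* i :* u := C :* (u :* i)) refl (C k) (u ⁻¹ᴳ) u ⟩
      C k * (u * u ⁻¹ᴳ)    ≡⟨ cong (C k *_) (1-z-inverseʳ (q^k*w≼ z≼1 (suc k)) (r^suc<1 k)) ⟩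
      C k * 1#             ≡⟨ *-identityʳ (C k) ⟩
      C k                  ∎
      where u = 1# - q ^ suc k * z

    -- Comes from (z ; q)_{k+1} = (1 - z)(qz ; q)_k, and ties `C` to the denominators of the ₂φ₁
    -- series.
    C-poch : ∀ k → C k * poch (q * z) q k ≡ c
    C-poch zero    = *-identityʳ c
    C-poch (suc k) = begin
      C (suc k) * (Y * (1# - q ^ k * (q * z)))
        ≡⟨ solve 5 (λ C Y a q z → C :* (Y :* (con 1# :- a :* (q :* z)))
             := C :* (con 1# :- a :* q :* z) :* Y) refl (C (suc k)) Y (q ^ k) q z ⟩
      C (suc k) * (1# - q ^ suc k * z) * Y      ≡⟨ cong (_* Y) (C-suc k) ⟩
      C k * Y                                   ≡⟨ C-poch k ⟩
      c                                         ∎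
      where Y = poch (q * z) q k

    -- R k j = C k − ∑_{i<j} [ k + i , k ] z^i, the tail of the q-binomial series of C k.
    R : ℕ → ℕ → 𝔾
    R k zero    = C k
    R k (suc j) = R k j - bin k j * z ^ j

    -- For k = 0 the series is geometric, so dropping one more term multiplies the tail by z. The
    -- first step writes the leading 1 as (1 - z)c.
    R-zero : ∀ j → R zero (suc j) ≡ z * R zero j
    R-zero zero = begin
      c - 1# * 1#              ≡⟨ cong (λ u → c - u * 1#) (sym c-inverse) ⟩
      c - (1# - z) * c * 1#    ≡⟨ solve 2 (λ c z → c :- (con 1# :- z) :* c :* con 1# := z :* c) refl c z ⟩
      z * c                    ∎
    R-zero (suc j) = begin
      R 0 (suc j) - 1# * (z ^ j * z)    ≡⟨ cong (_- 1# * (z ^ j * z)) (R-zero j) ⟩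
      z * R 0 j - 1# * (z ^ j * z)      ≡⟨ solve 3 (λ R h z → z :* R :- con 1# :* (h :* z)
                                             := z :* (R :- con 1# :* h)) refl (R 0 j) (z ^ j) z ⟩
      z * (R 0 j - 1# * z ^ j)          ≡⟨ cong (λ b → z * (R 0 j - b * z ^ j)) (sym (bin-zero j)) ⟩
      z * R 0 (suc j)                   ∎
      where
      bin-zero : ∀ j → bin zero j ≡ 1#
      bin-zero zero    = refl
      bin-zero (suc j) = refl

    -- For j = 0 this is the recursion `C-suc`. Each further step subtracts one term, which q-Pascal
    -- splits between the two tails; the factor z taken out accounts for the shift in j.
    R-suc : ∀ k j → R (suc k) (suc j) ≡ R k (suc j) + q ^ suc k * z * R (suc k) j
    R-suc k zero = begin
      C′ - 1# * 1#                                 ≡⟨ solve 2 (λ C e → C :- con 1# :* con 1#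
                                                       := C :* (con 1# :- e) :- con 1# :* con 1# :+ e :* C)
                                                       refl C′ (q ^ suc k * z) ⟩
      C′ * (1# - q ^ suc k * z) - 1# * 1# + q ^ suc k * z * C′
                                                   ≡⟨ cong (λ u → u - 1# * 1# + q ^ suc k * z * C′) (C-suc k) ⟩
      C k - 1# * 1# + q ^ suc k * z * C′           ∎
      where C′ = C (suc k)
    R-suc k (suc j) = begin
      R (suc k) (suc j) - (B₁ + h * B₂) * (z ^ j * z)
        ≡⟨ cong (_- (B₁ + h * B₂) * (z ^ j * z)) (R-suc k j) ⟩
      R k (suc j) + h * z * R (suc k) j - (B₁ + h * B₂) * (z ^ j * z)
        ≡⟨ solve 7 (λ R R′ B₁ B₂ h e z → R :+ h :* z :* R′ :- (B₁ :+ h :* B₂) :* (e :* z)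
             := R :- B₁ :* (e :* z) :+ h :* z :* (R′ :- B₂ :* e))
             refl (R k (suc j)) (R (suc k) j) B₁ B₂ h (z ^ j) z ⟩
      R k (suc (suc j)) + h * z * R (suc k) (suc j) ∎
      where
      B₁ = bin k (suc j)
      B₂ = bin (suc k) j
      h = q ^ suc k

    C-≼ : ∀ k → C k ≼ κ Q.* a k
    C-≼ zero    = subst (c ≼_) (sym (ℚP.*-identityʳ κ)) (1-z⁻¹≼ z≼r r<1)
    C-≼ (suc k) = subst (C (suc k) ≼_) (ℚP.*-assoc κ (a k) _)
      (≼-* (C-≼ k) (1-z⁻¹≼ (q^k*w≼ z≼1 (suc k)) (r^suc<1 k)))

    -- Induction along `R-zero` and `R-suc`. As |q^(k+1) z| ≤ r^(k+1) r, the two bounds add up by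
    -- `a-pascal` to exactly the bound required.
    R-≼ : ∀ k j → R k j ≼ κ Q.* a k Q.* r ^ℚ j
    R-≼ k zero = subst (C k ≼_) (sym (ℚP.*-identityʳ (κ Q.* a k))) (C-≼ k)
    R-≼ zero (suc j) = subst₂ _≼_ (sym (R-zero j))
      (trans (ℚP.*-comm r _) (ℚP.*-assoc (κ Q.* 1ℚ) (r ^ℚ j) r)) (≼-* z≼r (R-≼ zero j))
    R-≼ (suc k) (suc j) = subst₂ _≼_ (sym (R-suc k j)) sums
      (≼-+ (R-≼ k (suc j)) (≼-* (≼-* (≼-^ q≼r (suc k)) z≼r) (R-≼ (suc k) j)))
      where
      sums : κ Q.* a k Q.* (r ^ℚ j Q.* r) Q.+ r ^ℚ suc k Q.* r Q.* (κ Q.* a (suc k) Q.* r ^ℚ j)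
        ≡ κ Q.* a (suc k) Q.* (r ^ℚ j Q.* r)
      sums = trans
        (ℚS.solve 6 (λ κ x y h e r → κ ℚS.:* x ℚS.:* (e ℚS.:* r) ℚS.:+ h ℚS.:* r ℚS.:* (κ ℚS.:* y ℚS.:* e)
          ℚS.:= κ ℚS.:* (x ℚS.:+ h ℚS.:* y) ℚS.:* (e ℚS.:* r)) refl κ (a k) (a (suc k)) (r ^ℚ suc k) (r ^ℚ j) r)
        (cong (λ u → κ Q.* u Q.* (r ^ℚ j Q.* r)) (a-pascal k))

    -- The factor 1 - α contributes 2; each later factor is at most 1 + r^i with i ≥ 1 and is
    -- absorbed by `a-*[1+r^]≤`.
    poch-suc-≼ : ∀ k → poch α q (suc k) ≼ (1ℚ Q.+ 1ℚ) Q.* a k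
    poch-suc-≼ zero = ≼-* 1≼1 (≼-- 1≼1 (q^k*w≼ α≼1 0))
    poch-suc-≼ (suc k) = ≼-mono (≼-* (poch-suc-≼ k) (≼-- 1≼1 (q^k*w≼ α≼1 (suc k))))
      (ℚP.≤-trans (ℚP.≤-reflexive (ℚP.*-assoc (1ℚ Q.+ 1ℚ) (a k) (1ℚ Q.+ r ^ℚ suc k)))
        (*-mono-≤-nonneg 0≤2
          (*-nonneg (0≤a k) (+-nonneg (ℚP.<⇒≤ 0<1) (0≤r^ (suc k)))) ℚP.≤-refl (a-*[1+r^]≤ k)))

    poch-≼ : ∀ k → poch α q k ≼ (1ℚ Q.+ 1ℚ) Q.* A
    poch-≼ zero    = ≼-mono 1≼1 (ℚP.≤-trans
      (≤-by {1ℚ} 1ℚ (ℚP.<⇒≤ 0<1) refl)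
      (2*-mono (ℚP.<⇒≤ 0<1) 1≤A))
    poch-≼ (suc k) = ≼-mono (poch-suc-≼ k) (2*-mono (0≤a k) (a≤A k))

    D : ℕ → 𝔾
    D k = poch α q k * t ^ k

    -- The bound depends on k + j alone, so all N terms in `T-S` share the bound K r^N.
    D*R-≼ : ∀ k j → D k * R k j ≼ K Q.* r ^ℚ (k ℕ.+ j)
    D*R-≼ k j = ≼-mono (≼-* (≼-* (poch-≼ k) (≼-^ t≼r k)) (R-≼ k j)) (ℚP.≤-trans
      (*-mono-≤-nonneg 0≤2Ar (*-nonneg (*-nonneg 0≤κ (0≤a k)) (0≤r^ j)) ℚP.≤-refl
        (*-mono-≤-nonneg (*-nonneg 0≤κ 0≤A) (0≤r^ j)
          (*-mono-≤-nonneg 0≤κ (0≤a k) ℚP.≤-refl (a≤A k)) ℚP.≤-refl))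
      (ℚP.≤-reflexive (trans
        (ℚS.solve 4 (λ x y u v → x ℚS.:* u ℚS.:* (y ℚS.:* v) ℚS.:= x ℚS.:* y ℚS.:* (u ℚS.:* v)) refl
          ((1ℚ Q.+ 1ℚ) Q.* A) (κ Q.* A) (r ^ℚ k) (r ^ℚ j))
        (cong (K Q.*_) (sym (Geometric.^-distribˡ-+-* r k j))))))
      where
      0≤2Ar = *-nonneg (*-nonneg 0≤2 0≤A) (0≤r^ k)

    -- U N and S N are the partial sums of the ₂φ₁ series and of the generating function.
    T S U : ℕ → 𝔾
    T N = ∑ N (λ k → D k * C k)
    S N = ∑ N (λ m → ∑ (suc m) (λ k → D k * (bin k (m ∸ k) * z ^ (m ∸ k))))
    U N = ∑ N (φ-term α q (q * z) q t)

    -- The second upper parameter is q, so its factor (q ; q)_k cancels the one below, and `C-poch`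
    -- replaces 1 / (qz ; q)_k by (1 - z) C_k. The chain runs from right to left and inserts 1 = X Y
    -- I.
    φ-term≡ : q * z ≼ r → ∀ k → φ-term α q (q * z) q t k ≡ (1# - z) * (D k * C k)
    φ-term≡ qz≼r k = sym (begin
      (1# - z) * (P * t ^ k * C k)
        ≡⟨ sym (*-identityʳ _) ⟩
      (1# - z) * (P * t ^ k * C k) * 1#
        ≡⟨ cong ((1# - z) * (P * t ^ k * C k) *_) (sym (poch-poch-inverse q (q * z) q≼r qz≼r k k)) ⟩
      (1# - z) * (P * t ^ k * C k) * (X * Y * I)
        ≡⟨ solve 7 (λ u P e C X Y I → u :* (P :* e :* C) :* (X :* Y :* I)
             := u :* (C :* Y) :* (P :* X :* I :* e)) refl (1# - z) P (t ^ k) (C k) X Y I ⟩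
      (1# - z) * (C k * Y) * (P * X * I * t ^ k)
        ≡⟨ cong (λ u → u * (P * X * I * t ^ k)) (trans (cong ((1# - z) *_) (C-poch k)) c-inverse) ⟩
      1# * (P * X * I * t ^ k)
        ≡⟨ *-identityˡ _ ⟩
      P * X * I * t ^ k ∎)
      where
      P = poch α q k
      X = poch q q k
      Y = poch (q * z) q k
      I = (X * Y) ⁻¹ᴳ

    qz≼r : q * z ≼ r
    qz≼r = subst (q * z ≼_) (ℚP.*-identityʳ r) (≼-* q≼r z≼1)

    U≡[1-z]*T : ∀ N → U N ≡ (1# - z) * T N
    U≡[1-z]*T N = trans (∑-cong N (λ k _ → φ-term≡ qz≼r k)) (sym (*-distribˡ-∑ (1# - z) _ N))

    c*U≡T : ∀ N → c * U N ≡ T N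
    c*U≡T N = begin
      c * U N                  ≡⟨ cong (c *_) (U≡[1-z]*T N) ⟩
      c * ((1# - z) * T N)     ≡⟨ solve 3 (λ c u T → c :* (u :* T) := u :* c :* T) refl c (1# - z) (T N) ⟩
      (1# - z) * c * T N       ≡⟨ cong (_* T N) c-inverse ⟩
      1# * T N                 ≡⟨ *-identityˡ (T N) ⟩
      T N                      ∎

    -- From N to N + 1 each tail loses one term, and the lost terms together form the summand m = N
    -- of `S`.
    T-S : ∀ N → T N - S N ≡ ∑ N (λ k → D k * R k (N ∸ k))
    T-S zero    = refl
    T-S (suc N) = sym (begin
      ∑ (suc N) (λ k → D k * R k (suc N ∸ k))
        ≡⟨ ∑-cong (suc N) (λ { k (ℕ.s≤s k≤N) → trans
             (cong (λ i → D k * R k i) (ℕP.+-∸-assoc 1 k≤N))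
             (solve 3 (λ D R b → D :* (R :- b) := D :* R :- D :* b) refl
               (D k) (R k (N ∸ k)) (bin k (N ∸ k) * z ^ (N ∸ k))) }) ⟩
      ∑ (suc N) (λ k → D k * R k (N ∸ k) - D k * (bin k (N ∸ k) * z ^ (N ∸ k)))
        ≡⟨ ∑-distrib-- _ _ (suc N) ⟩
      ∑ N (λ k → D k * R k (N ∸ k)) + D N * R N (N ∸ N) - s
        -- The entry k = N is new: its tail has dropped nothing and is all of `C N`.
        ≡⟨ cong₂ (λ u i → u + D N * R N i - s) (sym (T-S N)) (ℕP.n∸n≡0 N) ⟩
      T N - S N + D N * C N - s
        ≡⟨ solve 4 (λ T S d s → T :- S :+ d :- s := (T :+ d) :- (S :+ s)) refl (T N) (S N) (D N * C N) s ⟩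
      T (suc N) - S (suc N) ∎)
      where s = ∑ (suc N) (λ k → D k * (bin k (N ∸ k) * z ^ (N ∸ k)))

    T-S-≼ : ∀ N → T N - S N ≼ fromℕ N Q.* (K Q.* r ^ℚ N)
    T-S-≼ N = subst (_≼ fromℕ N Q.* (K Q.* r ^ℚ N)) (sym (T-S N)) (∑-≼ N (*-nonneg 0≤K (0≤r^ N)) (λ k k<N →
      subst (λ i → D k * R k (N ∸ k) ≼ K Q.* r ^ℚ i) (ℕP.m+[n∸m]≡n (ℕP.<⇒≤ k<N)) (D*R-≼ k (N ∸ k))))

    -- ∑_{i<j} r^i = (1 − r^j) κ
    T-tail′ : ∀ j N → T (j ℕ.+ N) - T N ≼ K Q.* r ^ℚ N Q.* ((1ℚ Q.- r ^ℚ j) Q.* κ)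
    T-tail′ zero N = subst (_≼ K Q.* r ^ℚ N Q.* ((1ℚ Q.- 1ℚ) Q.* κ)) (sym (-‿inverseʳ (T N))) (0≼ (ℚP.≤-reflexive
      (ℚS.solve 2 (λ x κ → ℚS.con 0ℚ ℚS.:= x ℚS.:* ((ℚS.con 1ℚ ℚS.:- ℚS.con 1ℚ) ℚS.:* κ)) refl (K Q.* r ^ℚ N) κ)))
    T-tail′ (suc j) N = subst₂ _≼_
      (solve 3 (λ T d T₀ → T :- T₀ :+ d := T :+ d :- T₀) refl (T (j ℕ.+ N)) (D (j ℕ.+ N) * C (j ℕ.+ N)) (T N))
      sums
      -- The added term is covered by `D*R-≼` at 0, since `R k 0` is `C k`.
      (≼-+ (T-tail′ j N) (D*R-≼ (j ℕ.+ N) 0))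
      where
      e = r ^ℚ j
      f = r ^ℚ N
      sums : K Q.* f Q.* ((1ℚ Q.- e) Q.* κ) Q.+ K Q.* r ^ℚ (j ℕ.+ N ℕ.+ 0)
        ≡ K Q.* f Q.* ((1ℚ Q.- e Q.* r) Q.* κ)
      sums = trans (cong (λ x → K Q.* f Q.* ((1ℚ Q.- e) Q.* κ) Q.+ K Q.* x)
          (trans (trans (cong (r ^ℚ_) (ℕP.+-identityʳ (j ℕ.+ N))) (Geometric.^-distribˡ-+-* r j N))
            (trans (sym (ℚP.*-identityˡ (e Q.* f)))
              (cong (Q._* (e Q.* f)) (sym (⁻¹-inverseʳ (p<q⇒0<q-p r<1)))))))
        (ℚS.solve 5 (λ K e f r κ → K ℚS.:* f ℚS.:* ((ℚS.con 1ℚ ℚS.:- e) ℚS.:* κ)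
              ℚS.:+ K ℚS.:* ((ℚS.con 1ℚ ℚS.:- r) ℚS.:* κ ℚS.:* (e ℚS.:* f))
            ℚS.:= K ℚS.:* f ℚS.:* ((ℚS.con 1ℚ ℚS.:- e ℚS.:* r) ℚS.:* κ)) refl K e f r κ)

    T-tail : ∀ j N → T (j ℕ.+ N) - T N ≼ K Q.* r ^ℚ N Q.* κ
    T-tail j N = ≼-mono (T-tail′ j N) (≤-by (K Q.* r ^ℚ N Q.* (r ^ℚ j Q.* κ))
      (*-nonneg (*-nonneg 0≤K (0≤r^ N)) (*-nonneg (0≤r^ j) 0≤κ))
      (ℚS.solve 3 (λ x e κ → x ℚS.:* ((ℚS.con 1ℚ ℚS.:- e) ℚS.:* κ) ℚS.:+ x ℚS.:* (e ℚS.:* κ) ℚS.:= x ℚS.:* κ)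
        refl (K Q.* r ^ℚ N) (r ^ℚ j) κ))

    -- The partial sum of the ₂φ₁ series is allowed j extra terms, because the limit is later
    -- represented by a diagonal that has already summed further than N. The difference is -((T N -
    -- S N) + (T(j + N) - T N)).
    S-cU-≼ : ∀ j N → S N - c * U (j ℕ.+ N) ≼ error N
    S-cU-≼ j N = subst (_≼ error N)
      (trans (solve 3 (λ T T′ S → :- ((T :- S) :+ (T′ :- T)) := S :- T′) refl (T N) (T (j ℕ.+ N)) (S N))
        (cong (λ u → S N - u) (sym (c*U≡T (j ℕ.+ N)))))
      (≼-mono (≼-neg (≼-+ (T-S-≼ N) (T-tail j N)))
        (≤-by (K Q.* (fromℕ N Q.+ κ) Q.* r ^ℚ N)
          (*-nonneg (*-nonneg 0≤K (+-nonneg (fromℕ-nonneg N) 0≤κ)) (0≤r^ N))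
          (ℚS.solve 4 (λ K n κ e → n ℚS.:* (K ℚS.:* e) ℚS.:+ K ℚS.:* e ℚS.:* κ ℚS.:+ K ℚS.:* (n ℚS.:+ κ) ℚS.:* e
            ℚS.:= (ℚS.con 1ℚ ℚS.:+ ℚS.con 1ℚ) ℚS.:* K ℚS.:* (n ℚS.:+ κ) ℚS.:* e) refl K (fromℕ N) κ (r ^ℚ N))))

    U-tail : ∀ j N → U (j ℕ.+ N) - U N ≼ error N
    U-tail j N = subst (_≼ error N)
      (trans (solve 3 (λ u T T′ → u :* (T′ :- T) := u :* T′ :- u :* T) refl (1# - z) (T N) (T (j ℕ.+ N)))
        (sym (cong₂ _-_ (U≡[1-z]*T (j ℕ.+ N)) (U≡[1-z]*T N))))
      (≼-mono (≼-* (≼-- 1≼1 z≼1) (T-tail j N))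
        (≤-by ((1ℚ Q.+ 1ℚ) Q.* (K Q.* fromℕ N Q.* r ^ℚ N))
          (*-nonneg 0≤2 (*-nonneg (*-nonneg 0≤K (fromℕ-nonneg N)) (0≤r^ N)))
          (ℚS.solve 4 (λ K n κ e → (ℚS.con 1ℚ ℚS.:+ ℚS.con 1ℚ) ℚS.:* (K ℚS.:* e ℚS.:* κ)
              ℚS.:+ (ℚS.con 1ℚ ℚS.:+ ℚS.con 1ℚ) ℚS.:* (K ℚS.:* n ℚS.:* e)
            ℚS.:= (ℚS.con 1ℚ ℚS.:+ ℚS.con 1ℚ) ℚS.:* K ℚS.:* (n ℚS.:+ κ) ℚS.:* e) refl K (fromℕ N) κ (r ^ℚ N))))

    -- Splitting y^m as y^k y^(m-k) turns b^k into t^k and x^(m-k) into z^(m-k).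
    hahn-*-^ : ∀ {b x y} → z ≡ x * y → t ≡ b * y → ∀ m →
      hahn q m α b x * y ^ m ≡ ∑ (suc m) (λ k → D k * (bin k (m ∸ k) * z ^ (m ∸ k)))
    hahn-*-^ {b} {x} {y} refl refl m = begin
      hahn q m α b x * y ^ m
        ≡⟨ *-comm (hahn q m α b x) (y ^ m) ⟩
      y ^ m * hahn q m α b x
        ≡⟨ *-distribˡ-∑ (y ^ m) _ (suc m) ⟩
      ∑ (suc m) (λ k → y ^ m * (qBinomial q m k * poch α q k * b ^ k * x ^ (m ∸ k)))
        ≡⟨ ∑-cong (suc m) (λ { k (ℕ.s≤s k≤m) →
             termwise k (m ∸ k) (ℕP.m+[n∸m]≡n k≤m) (qBinomial≡bin m k k≤m) }) ⟩
      ∑ (suc m) (λ k → D k * (bin k (m ∸ k) * z ^ (m ∸ k))) ∎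
      where
      -- Naming m ∸ k as `j` lets the equation for m be matched by `refl`.
      termwise : ∀ k j {B B′} → k ℕ.+ j ≡ m → B ≡ B′ →
        y ^ m * (B * poch α q k * b ^ k * x ^ j) ≡ D k * (B′ * z ^ j)
      termwise k j {B} refl refl = begin
        y ^ (k ℕ.+ j) * (B * P * b ^ k * x ^ j)
          ≡⟨ cong (_* (B * P * b ^ k * x ^ j)) (^-distribˡ-+-* y k j) ⟩
        y ^ k * y ^ j * (B * P * b ^ k * x ^ j)
          ≡⟨ solve 6 (λ y₁ y₂ B P b x → y₁ :* y₂ :* (B :* P :* b :* x)
               := P :* (b :* y₁) :* (B :* (x :* y₂))) refl (y ^ k) (y ^ j) B P (b ^ k) (x ^ j) ⟩
        P * (b ^ k * y ^ k) * (B * (x ^ j * y ^ j))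
          ≡⟨ sym (cong₂ (λ u v → P * u * (B * v)) (^-*-distrib b y k) (^-*-distrib x y j)) ⟩
        P * t ^ k * (B * z ^ j) ∎
        where P = poch α q k

open import Defs

-- From uniform estimates on approximations to complex numbers and convergent series.

module Approximation where
  open Q using (_≤_; _<_)
  open Rational
  open +-*-Solver using (solve; _:+_; _:*_; _:-_; :-_; _:=_; con)
  module 𝔾 = Gaussian
  module GS = GaussianSeries
  open Gaussian using (𝔾; _⊕_; _≼_)

  -- Commutes with ring operations and division by computation; only the recursive constructions
  -- need the inductions that follow.
  approx : ℂ → ℕ → 𝔾
  approx z n = seq (re z) n ⊕ seq (im z) n

  approx-∑ : ∀ f N n → approx (∑< N f) n ≡ GS.∑ N (λ k → approx (f k) n)
  approx-∑ f zero    n = refl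
  approx-∑ f (suc N) n = cong (𝔾._+ approx (f N) n) (approx-∑ f N n)

  approx-^ : ∀ z k n → approx (z ^ k) n ≡ approx z n 𝔾.^ k
  approx-^ z zero    n = refl
  approx-^ z (suc k) n = cong (𝔾._* approx z n) (approx-^ z k n)

  approx-pochhammer : ∀ a q k n → approx (pochhammer a q k) n ≡ GS.poch (approx a n) (approx q n) k
  approx-pochhammer a q zero    n = refl
  approx-pochhammer a q (suc k) n = cong₂ (λ p h → p 𝔾.* (𝔾.1# 𝔾.- h 𝔾.* approx a n))
    (approx-pochhammer a q k n) (approx-^ q k n)

  approx-qBinomial : ∀ q q≠ m k n → approx (qBinomial q q≠ m k) n ≡ GS.qBinomial (approx q n) m k
  approx-qBinomial q q≠ m k n = cong₂ (λ u v → u 𝔾.* v 𝔾.⁻¹ᴳ) (approx-pochhammer q q m n)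
    (cong₂ 𝔾._*_ (approx-pochhammer q q k n) (approx-pochhammer q q (m ∸ k) n))

  approx-hahn : ∀ q q≠ m α x y n →
    approx (hahn q q≠ m α x y) n ≡ GS.hahn (approx q n) m (approx α n) (approx x n) (approx y n)
  approx-hahn q q≠ m α x y n = trans
    (approx-∑ (λ k → qBinomial q q≠ m k * pochhammer α q k * x ^ k * y ^ (m ∸ k)) (suc m) n)
    (GS.∑-cong (suc m) (λ k _ → cong₂ 𝔾._*_
      (cong₂ 𝔾._*_
        (cong₂ 𝔾._*_ (approx-qBinomial q q≠ m k n) (approx-pochhammer α q k n)) (approx-^ x k n))
      (approx-^ y (m ∸ k) n)))

  approx-φ-term : ∀ a₁ a₂ b₁ q z k (w≠0 : pochhammer q q k * pochhammer b₁ q k ≠0) n →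
    approx ((pochhammer a₁ q k * pochhammer a₂ q k)
      / pochhammer q q k * pochhammer b₁ q k ⟨ w≠0 ⟩ * z ^ k) n
    ≡ GS.φ-term (approx a₁ n) (approx a₂ n) (approx b₁ n) (approx q n) (approx z n) k
  approx-φ-term a₁ a₂ b₁ q z k w≠0 n = cong₂ 𝔾._*_
    (cong₂ (λ u v → u 𝔾.* v 𝔾.⁻¹ᴳ)
      (cong₂ 𝔾._*_ (approx-pochhammer a₁ q k n) (approx-pochhammer a₂ q k n))
      (cong₂ 𝔾._*_ (approx-pochhammer q q k n) (approx-pochhammer b₁ q k n)))
    (approx-^ z k n)

  √-lower-≤ : ∀ {p δ} → 0ℚ ≤ p → 0ℚ ≤ δ → p ≤ δ Q.* δ → ∀ n → √-lower p n ≤ δ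
  √-lower-≤ 0≤p 0≤δ p≤δ² n =
    𝔾.square-cancel-≤ 0≤δ (ℚP.≤-trans (proj₁ (proj₂ (√-lower-spec 0≤p n))) p≤δ²)

  -- Half of the gap e below `ε` bounds the modulus, and the other half is the uniform gap that the
  -- strict order demands.
  hasSum : ∀ {f s} →
    (∀ {δ} → 0ℚ < δ → Eventually (λ N → Eventually (λ n → approx (∑< N f - s) n ≼ δ))) → HasSum f s
  hasSum {f} {s} small ε (gap e 0<e (M , 0+e≤ε)) = proj₁ near , λ N N≥ →
    gap δ 0<δ (Eventually-map (below N) (Eventually-× (M , 0+e≤ε) (proj₂ near N N≥)))
    where
    δ = e Q.* ½
    0<δ : 0ℚ < δ
    0<δ = half-pos 0<e
    near = small 0<δ
    below : ∀ N n → (0ℚ Q.+ e ≤ seq ε n) × (approx (∑< N f - s) n ≼ δ) →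
      seq ∣ ∑< N f - s ∣ n Q.+ δ ≤ seq ε n
    below N n (e≤ε , close) = begin
      seq ∣ ∑< N f - s ∣ n Q.+ δ
        ≤⟨ ℚP.+-monoˡ-≤ δ (√-lower-≤ (normSq-nonneg (∑< N f - s) n) (ℚP.<⇒≤ 0<δ) (𝔾.normSq≤ close) n) ⟩
      δ Q.+ δ      ≡⟨ half+half e ⟩
      e            ≡⟨ sym (ℚP.+-identityˡ e) ⟩
      0ℚ Q.+ e     ≤⟨ e≤ε ⟩
      seq ε n      ∎
      where open ℚP.≤-Reasoning

  -- Two entries of `s` are compared through a nearby real `u`, itself Cauchy. Each of the three
  -- distances is at most ε/4.
  near-reals⇒cauchy : ∀ (s : ℕ → ℚ) →
    (∀ {δ} → 0ℚ < δ → ∃ λ u → Eventually (λ n → Q.∣ s n Q.- seq u n ∣ ≤ δ)) → Cauchy s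
  near-reals⇒cauchy s near ε 0<ε with near (half-pos (half-pos 0<ε))
  ... | u , M , s≈u with cauchy u (ε Q.* ½ Q.* ½) (half-pos (half-pos 0<ε))
  ...   | N , c = M ℕ.⊔ N , λ m n m≥ n≥ → begin-strict
    Q.∣ s m Q.- s n ∣
      ≡⟨ cong Q.∣_∣ (solve 4 (λ a b c d → a :- d := (a :- b) :+ (b :- c) :+ (c :- d))
           refl (s m) (seq u m) (seq u n) (s n)) ⟩
    Q.∣ (s m Q.- seq u m) Q.+ (seq u m Q.- seq u n) Q.+ (seq u n Q.- s n) ∣
      ≤⟨ ℚP.≤-trans (ℚP.∣p+q∣≤∣p∣+∣q∣ ((s m Q.- seq u m) Q.+ (seq u m Q.- seq u n)) (seq u n Q.- s n))
           (ℚP.+-monoˡ-≤ Q.∣ seq u n Q.- s n ∣ (ℚP.∣p+q∣≤∣p∣+∣q∣ (s m Q.- seq u m) (seq u m Q.- seq u n))) ⟩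
    Q.∣ s m Q.- seq u m ∣ Q.+ Q.∣ seq u m Q.- seq u n ∣ Q.+ Q.∣ seq u n Q.- s n ∣
      <⟨ ℚP.+-mono-<-≤ (ℚP.+-mono-≤-< (s≈u m (CauchySequences.≤ˡ M N m≥))
           (c m n (CauchySequences.≤ʳ M N m≥) (CauchySequences.≤ʳ M N n≥)))
           (subst (_≤ δ) (∣p-q∣≡∣q-p∣ (s n) (seq u n)) (s≈u n (CauchySequences.≤ˡ M N n≥))) ⟩
    δ Q.+ δ Q.+ δ
      ≤⟨ ≤-by δ (ℚP.<⇒≤ (half-pos (half-pos 0<ε)))
           (solve 1 (λ ε → ε :* con ½ :* con ½ :+ ε :* con ½ :* con ½ :+ ε :* con ½ :* con ½
              :+ ε :* con ½ :* con ½ := ε) refl ε) ⟩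
    ε ∎
    where
    open ℚP.≤-Reasoning
    δ = ε Q.* ½ Q.* ½

  -- When the tails are small uniformly in the index of approximation, the diagonal
  -- n ↦ (∑_{k<n} f k)_n represents the sum of the series.
  module Diagonal (f : ℕ → ℂ) (err : ℕ → ℚ)
    (err-vanishes : ∀ {δ} → 0ℚ < δ → Eventually (λ N → err N ≤ δ))
    (tail : Eventually (λ n → ∀ j N → approx (∑< (j ℕ.+ N) f) n 𝔾.- approx (∑< N f) n ≼ err N))
    where

    -- On the diagonal n counts summands as well as indexing the approximation, so n ≥ N leaves n ∸
    -- N terms beyond the first N.
    tail′ : ∀ N → Eventually (λ n → approx (∑< n f) n 𝔾.- approx (∑< N f) n ≼ err N)
    tail′ N = proj₁ tail ℕ.⊔ N , λ n n≥ →
      subst (λ i → approx (∑< i f) n 𝔾.- approx (∑< N f) n ≼ err N)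
        (ℕP.m∸n+n≡m (CauchySequences.≤ʳ (proj₁ tail) N n≥))
        (proj₂ tail n (CauchySequences.≤ˡ (proj₁ tail) N n≥) (n ∸ N) N)

    near : ∀ {δ} → 0ℚ < δ →
      ∃ λ N → Eventually (λ n → approx (∑< n f) n 𝔾.- approx (∑< N f) n ≼ δ)
    near 0<δ with err-vanishes 0<δ
    ... | N , err≤δ = N , Eventually-map (λ n b → 𝔾.≼-mono b (err≤δ N ℕP.≤-refl)) (tail′ N)

    re-cauchy : Cauchy (λ n → seq (re (∑< n f)) n)
    re-cauchy = near-reals⇒cauchy (λ n → seq (re (∑< n f)) n) (λ 0<δ → let N , close = near 0<δ in re (∑< N f) ,
      Eventually-map (λ n → 𝔾.≼⇒∣re∣≤ {approx (∑< n f) n 𝔾.- approx (∑< N f) n}) close)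

    im-cauchy : Cauchy (λ n → seq (im (∑< n f)) n)
    im-cauchy = near-reals⇒cauchy (λ n → seq (im (∑< n f)) n) (λ 0<δ → let N , close = near 0<δ in im (∑< N f) ,
      Eventually-map (λ n → 𝔾.≼⇒∣im∣≤ {approx (∑< n f) n 𝔾.- approx (∑< N f) n}) close)

    sum : ℂ
    sum = mkℝ (λ n → seq (re (∑< n f)) n) re-cauchy +i mkℝ (λ n → seq (im (∑< n f)) n) im-cauchy

    sum-hasSum : HasSum f sum
    sum-hasSum = hasSum {f} {sum} λ 0<δ → Eventually-map (λ N err≤δ → Eventually-map (λ n b →
        𝔾.≼-mono (subst (_≼ err N) (flip (approx (∑< n f) n) (approx (∑< N f) n)) (𝔾.≼-neg b)) err≤δ)
        (tail′ N))
      (err-vanishes 0<δ)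
      where
      module S = Gaussian.𝔾-Solver
      flip : ∀ u v → 𝔾.- (u 𝔾.- v) ≡ v 𝔾.- u
      flip = S.solve 2 (λ u v → S.:- (u S.:- v) S.:= v S.:- u) refl

  -- The norm bound holds because (1 - ε/2)² = 1 - ε + ε²/4. That 1 - ε/2 is nonnegative follows
  -- from ε ≤ 1, checked after doubling.
  normSq≤1-ε⇒≼ : ∀ z {ε} → 0ℚ < ε → 𝔾.normSq z Q.+ ε ≤ 1ℚ → z ≼ 1ℚ Q.- ε Q.* ½
  normSq≤1-ε⇒≼ z {ε} 0<ε p+ε≤1 = 𝔾.bound
    (ℚP.*-cancelʳ-≤-pos (1ℚ Q.+ 1ℚ) {{Q.positive (+-pos 0<1 0<1)}}
      (≤-by _ (+-nonneg (+-nonneg (p≤q⇒0≤q-p p+ε≤1) (𝔾.normSq-nonneg z)) (ℚP.<⇒≤ 0<1))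
        (solve 2 (λ p ε → con 0ℚ :* (con 1ℚ :+ con 1ℚ) :+ ((con 1ℚ :- (p :+ ε)) :+ p :+ con 1ℚ)
            := (con 1ℚ :- ε :* con ½) :* (con 1ℚ :+ con 1ℚ)) refl (𝔾.normSq z) ε)))
    (≤-by _ (+-nonneg (p≤q⇒0≤q-p p+ε≤1) (p*p-nonneg (ε Q.* ½)))
      (solve 2 (λ p ε → p :+ ((con 1ℚ :- (p :+ ε)) :+ ε :* con ½ :* (ε :* con ½))
          := (con 1ℚ :- ε :* con ½) :* (con 1ℚ :- ε :* con ½)) refl (𝔾.normSq z) ε))

  ∣z∣<1⇒≼ : ∀ z → ∣ z ∣ <ᴿ 1ℝ → ∃ λ r → 0ℚ ≤ r × r < 1ℚ × Eventually (λ n → approx z n ≼ r)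
  -- Nonnegativity of the radius is read off the bound at one sufficiently late index.
  ∣z∣<1⇒≼ z ∣z∣<1 = 1ℚ Q.- δ , 𝔾.nonneg (proj₂ within (proj₁ within) ℕP.≤-refl) ,
    <-by δ (half-pos 0<ε) (solve 1 (λ δ → con 1ℚ :- δ :+ δ := con 1ℚ) refl δ) , within
    where
    open _<ᴿ_ (NonVanishing.∣z∣<1⇒normSq<1 z ∣z∣<1) renaming (ε-positive to 0<ε)
    δ = ε Q.* ½
    within : Eventually (λ n → approx z n ≼ 1ℚ Q.- δ)
    within = Eventually-map (λ n → normSq≤1-ε⇒≼ (approx z n) 0<ε) separated

  ^-≼1 : ∀ z k i → approx z i ≼ 1ℚ → approx (z ^ k) i ≼ 1ℚ
  ^-≼1 z k i z≼1 = subst₂ _≼_ (sym (approx-^ z k i)) (Geometric.1^n≡1 k) (𝔾.≼-^ z≼1 k)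

  ⊔-lub-< : ∀ {p q r} → p < r → q < r → p Q.⊔ q < r
  ⊔-lub-< {p} {q} p<r q<r with ℚP.⊔-sel p q
  ... | inj₁ eq = subst (_< _) (sym eq) p<r
  ... | inj₂ eq = subst (_< _) (sym eq) q<r

  ≈-refl : ∀ z → z ≈ z
  ≈-refl z = refl′ (re z) , refl′ (im z)
    where
    refl′ : ∀ x → x ≈ᴿ x
    refl′ x ε 0<ε = 0 , λ n _ → subst (_< ε) (cong Q.∣_∣ (sym (ℚP.+-inverseʳ (seq x n)))) 0<ε

open Approximation

-- The generating function over the complex numbers, its terms known through their approximations.

module GeneratingFunction (q α b x y : ℂ)
  (∣q∣<1 : ∣ q ∣ <ᴿ 1ℝ) (∣xy∣<1 : ∣ x * y ∣ <ᴿ 1ℝ) (∣by∣<1 : ∣ b * y ∣ <ᴿ 1ℝ)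
  (α≼1 : ∀ i → approx q i Gaussian.≼ 1ℚ → approx α i Gaussian.≼ 1ℚ)
  (hahn-term φ-term : ℕ → ℂ) (c : ℂ)
  (approx-hahn-term : ∀ m i → approx (hahn-term m) i ≡
    GaussianSeries.hahn (approx q i) m (approx α i) (approx b i) (approx x i) Gaussian.*
      approx y i Gaussian.^ m)
  (approx-φ-term : ∀ k i → approx (φ-term k) i ≡
    GaussianSeries.φ-term (approx α i) (approx q i) (approx (q * (x * y)) i) (approx q i)
      (approx (b * y) i) k)
  (approx-c : ∀ i → approx c i ≡ approx (1ℂ - x * y) i Gaussian.⁻¹ᴳ)
  where
  open Q using (_≤_; _<_)

  q-bound = ∣z∣<1⇒≼ q ∣q∣<1
  z-bound = ∣z∣<1⇒≼ (x * y) ∣xy∣<1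
  t-bound = ∣z∣<1⇒≼ (b * y) ∣by∣<1

  rq rz rt r : ℚ
  rq = proj₁ q-bound
  rz = proj₁ z-bound
  rt = proj₁ t-bound
  r  = rq Q.⊔ rz Q.⊔ rt

  0≤r : 0ℚ ≤ r
  0≤r = ℚP.≤-trans (proj₁ (proj₂ q-bound)) (ℚP.≤-trans (ℚP.p≤p⊔q rq rz) (ℚP.p≤p⊔q (rq Q.⊔ rz) rt))

  r<1 : r < 1ℚ
  r<1 = ⊔-lub-< (⊔-lub-< (proj₁ (proj₂ (proj₂ q-bound))) (proj₁ (proj₂ (proj₂ z-bound))))
    (proj₁ (proj₂ (proj₂ t-bound)))

  open Geometric.EulerProduct r 0≤r r<1 using (error; error-vanishes)

  -- The radius r is fixed before the index i, so the error bounds obtained from `K` are the same at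
  -- every such i.
  record Bounds (i : ℕ) : Set where
    field
      q≼r : approx q i Gaussian.≼ r
      z≼r : approx (x * y) i Gaussian.≼ r
      t≼r : approx (b * y) i Gaussian.≼ r

    module K = GaussianSeries.Kernel (approx q i) (approx (x * y) i) (approx (b * y) i)
      (approx α i) r 0≤r r<1 q≼r z≼r t≼r (α≼1 i (Gaussian.≼-mono q≼r (ℚP.<⇒≤ r<1)))

  bounds : Eventually Bounds
  bounds = Eventually-map (λ i ((q≼ , z≼) , t≼) → record
      { q≼r = Gaussian.≼-mono q≼ (ℚP.≤-trans (ℚP.p≤p⊔q rq rz) (ℚP.p≤p⊔q (rq Q.⊔ rz) rt))
      ; z≼r = Gaussian.≼-mono z≼ (ℚP.≤-trans (ℚP.p≤q⊔p rq rz) (ℚP.p≤p⊔q (rq Q.⊔ rz) rt))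
      ; t≼r = Gaussian.≼-mono t≼ (ℚP.p≤q⊔p (rq Q.⊔ rz) rt) })
    (Eventually-× (Eventually-× (proj₂ (proj₂ (proj₂ q-bound))) (proj₂ (proj₂ (proj₂ z-bound))))
      (proj₂ (proj₂ (proj₂ t-bound))))

  module _ {i : ℕ} (bd : Bounds i) where
    open Bounds bd

    approx-φ-sum : ∀ N → approx (∑< N φ-term) i ≡ K.U N
    approx-φ-sum N = trans (approx-∑ φ-term N i)
      (GaussianSeries.∑-cong N (λ k _ → approx-φ-term k i))

    approx-hahn-sum : ∀ N → approx (∑< N hahn-term) i ≡ K.S N
    approx-hahn-sum N = trans (approx-∑ hahn-term N i)
      (GaussianSeries.∑-cong N (λ m _ → trans (approx-hahn-term m i) (K.hahn-*-^ refl refl m)))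

  module Φ = Diagonal φ-term error error-vanishes
    (Eventually-map (λ i bd j N → subst₂ (λ u v → u Gaussian.- v Gaussian.≼ error N)
        (sym (approx-φ-sum bd (j ℕ.+ N))) (sym (approx-φ-sum bd N))
        (Bounds.K.U-tail bd j N))
      bounds)

  c*Φ-hasSum : HasSum hahn-term (c * Φ.sum)
  c*Φ-hasSum = hasSum {hahn-term} {c * Φ.sum} λ 0<δ → Eventually-map (λ N err≤δ →
      Eventually-map (λ i (bd , N≤i) → Gaussian.≼-mono (close N i bd N≤i) err≤δ)
        (Eventually-× bounds (N , λ _ N≤i → N≤i)))
    (error-vanishes 0<δ)
    where
    close : ∀ N i → Bounds i → N ℕ.≤ i → approx (∑< N hahn-term - c * Φ.sum) i Gaussian.≼ error N
    close N i bd N≤i = subst₂ (λ s u → s Gaussian.- u Gaussian.≼ error N)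
      (sym (approx-hahn-sum bd N))
      (cong₂ Gaussian._*_ (sym (approx-c i))
        (trans (cong K.U (ℕP.m∸n+n≡m N≤i)) (sym (approx-φ-sum bd i))))
      -- At index i the sum of the ₂φ₁ series is represented by its first i terms, i ∸ N more than
      -- N.
      (K.S-cU-≼ (i ∸ N) N)
      where open Bounds bd

  conclusion : ∃[ S ] ∃[ φ ] (HasSum hahn-term S × HasSum φ-term φ × S ≈ c * φ)
  conclusion = c * Φ.sum , Φ.sum , c*Φ-hasSum , Φ.sum-hasSum , ≈-refl (c * Φ.sum)

-- `α` generalises q^n, whose approximations are bounded by 1 wherever those of q are. Non-vanishing
-- proofs are variables here, so any choice of them can be supplied.
hahn-generating-function : (q α b x y : ℂ)
  (∣q∣<1 : ∣ q ∣ <ᴿ 1ℝ) (∣xy∣<1 : ∣ x * y ∣ <ᴿ 1ℝ) (∣by∣<1 : ∣ b * y ∣ <ᴿ 1ℝ)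
  (α≼1 : ∀ i → approx q i Gaussian.≼ 1ℚ → approx α i Gaussian.≼ 1ℚ)
  (q≠ : ∀ k → pochhammer q q k ≠0) (qxy≠ : ∀ k → pochhammer (q * (x * y)) q k ≠0)
  (1-xy≠0 : 1ℂ - x * y ≠0) →
  ∃[ S ] ∃[ φ ]
    ( HasSum (λ m → hahn q q≠ m α b x * y ^ m) S
    × Is₂φ₁ α q (q * (x * y)) q (b * y) q≠ qxy≠ φ
    × S ≈ 1ℂ / (1ℂ - x * y) ⟨ 1-xy≠0 ⟩ * φ )
hahn-generating-function q α b x y ∣q∣<1 ∣xy∣<1 ∣by∣<1 α≼1 q≠ qxy≠ 1-xy≠0 =
  GeneratingFunction.conclusion q α b x y ∣q∣<1 ∣xy∣<1 ∣by∣<1 α≼1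
    (λ m → hahn q q≠ m α b x * y ^ m)
    (λ k → (pochhammer α q k * pochhammer q q k)
      / pochhammer q q k * pochhammer (q * (x * y)) q k ⟨ w≠0 k ⟩ * (b * y) ^ k)
    (1ℂ / (1ℂ - x * y) ⟨ 1-xy≠0 ⟩)
    (λ m i → cong₂ Gaussian._*_ (approx-hahn q q≠ m α b x i) (approx-^ y m i))
    (λ k i → approx-φ-term α q (q * (x * y)) q (b * y) k (w≠0 k) i)
    -- The quotient 1 / (1 - xy) is by definition 1 times the inverse.
    (λ i → Gaussian.*-identityˡ (approx (1ℂ - x * y) i Gaussian.⁻¹ᴳ))
  where
  w≠0 : ∀ k → pochhammer q q k * pochhammer (q * (x * y)) q k ≠0
  w≠0 k = *-≠0 (pochhammer q q k) (pochhammer (q * (x * y)) q k) (q≠ k) (qxy≠ k)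

theorem7 : (q : ℂ) (∣q∣<1 : ∣ q ∣ <ᴿ 1ℝ) (n : ℕ) (b x y : ℂ)
    (∣xy∣<1 : ∣ x * y ∣ <ᴿ 1ℝ) (∣by∣<1 : ∣ b * y ∣ <ᴿ 1ℝ) →
    ∃[ S ] ∃[ φ ]
    ( HasSum (λ m → hahn q (pochhammer≠0 q ∣q∣<1) m (q ^ n) b x * y ^ m) S
    × Is₂φ₁ (q ^ n) q (q * (x * y)) q (b * y)
    (pochhammer≠0 q ∣q∣<1) (pochhammer-q*z≠0 q (x * y) ∣q∣<1 ∣xy∣<1) φ
    × S ≈ 1ℂ / (1ℂ - x * y) ⟨ 1-z≠0 (x * y) ∣xy∣<1 ⟩ * φ )
theorem7 q ∣q∣<1 n b x y ∣xy∣<1 ∣by∣<1 =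
  hahn-generating-function q (q ^ n) b x y ∣q∣<1 ∣xy∣<1 ∣by∣<1 (^-≼1 q n)
    (pochhammer≠0 q ∣q∣<1) (pochhammer-q*z≠0 q (x * y) ∣q∣<1 ∣xy∣<1) (1-z≠0 (x * y) ∣xy∣<1)
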